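{- For every integer $h\ge2$ and every real $r>0$, $$\lambda_h(r)^2\ge\lambda_{h-1}(r)\,\lambda_{h+1}(r),$$ and hence $$\Lambda_h(r)^2\ge\Lambda_{h-1}(r)\,\Lambda_{h+1}(r).$$
   Context: For $r>0$ and $h\ge1$, $A_h(r)$ is the $h\times h$ real symmetric tridiagonal matrix with zero diagonal and $(A_h(r))_{i,i+1}=(A_h(r))_{i+1,i}=r^{(i-1)/2}$ for $1\le i\le h-1$ (so $A_1(r)$ is the $1\times1$ zero matrix). $\lambda_h(r)$ denotes the spectral radius of $A_h(r)$ (so $\lambda_1(r)=0$), and $\Lambda_h(r)=\lambda_h(r)^2$. -}

module Defs where

open import Algebra.Bundles using (CommutativeRing; RawMonoid)
open import Algebra.Definitions using (Invertible)
open import Algebra.Structures using (IsCommutativeRing)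
open import Data.Fin.Base using (Fin; toℕ)
open import Data.Nat.Base as ℕ using (ℕ; suc)
open import Data.Product.Base using (∃-syntax; _×_; _,_; proj₁)
open import Data.Sum.Base using (inj₁; inj₂)
open import Data.Vec.Functional using (Vector)
open import Level using (Level) renaming (suc to lsuc)
open import Relation.Binary.Core using (Rel)
open import Relation.Binary.Structures using (IsDecTotalOrder)
open import Relation.Nullary.Decidable using (yes; no)
open import Relation.Nullary.Negation using (¬_)
open import Relation.Unary using (Pred)

import Algebra.Definitions.RawMonoid
import Algebra.Properties.Ring
import Algebra.Properties.Semiring.Exp
import Data.Nat.Properties as ℕₚ
import Relation.Binary.Construct.NonStrictToStrict
import Relation.Binary.Reasoning.Setoid

private variable
  ℓ : Level

-- The standard library has no real numbers.  We use their classical axiomatic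
-- description: a Dedekind-complete (totally) ordered field, which is unique up
-- to isomorphism.  The order is decidable because the axioms are the classical
-- ones.
record CompleteOrderedField (ℓ : Level) : Set (lsuc ℓ) where
  infix  8 -_
  infixl 7 _*_
  infixl 6 _+_
  infix  4 _≈_ _≤_
  field
    Carrier : Set ℓ
    _≈_     : Rel Carrier ℓ
    _≤_     : Rel Carrier ℓ
    _+_     : Carrier → Carrier → Carrier
    _*_     : Carrier → Carrier → Carrier
    -_      : Carrier → Carrier
    0#      : Carrier
    1#      : Carrier

    isCommutativeRing : IsCommutativeRing _≈_ _+_ _*_ -_ 0# 1#
    0≉1               : ¬ 0# ≈ 1#
    invertible        : ∀ x → ¬ x ≈ 0# → Invertible _≈_ 1# _*_ x

    isDecTotalOrder : IsDecTotalOrder _≈_ _≤_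
    +-monoˡ-≤       : ∀ z {x y} → x ≤ y → x + z ≤ y + z
    *-nonNeg        : ∀ {x y} → 0# ≤ x → 0# ≤ y → 0# ≤ x * y

  IsUpperBound : Pred Carrier ℓ → Carrier → Set ℓ
  IsUpperBound P u = ∀ x → P x → x ≤ u

  IsSupremum : Pred Carrier ℓ → Carrier → Set ℓ
  IsSupremum P s = IsUpperBound P s × (∀ u → IsUpperBound P u → s ≤ u)

  field
    complete : (P : Pred Carrier ℓ) → ∃[ x ] P x → ∃[ u ] IsUpperBound P u →
               ∃[ s ] IsSupremum P s

  commutativeRing : CommutativeRing ℓ ℓ
  commutativeRing = record { isCommutativeRing = isCommutativeRing }

  open CommutativeRing commutativeRing public
    hiding (Carrier; _≈_; _+_; _*_; -_; 0#; 1#; isCommutativeRing)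

  module Order = IsDecTotalOrder isDecTotalOrder

  open Relation.Binary.Construct.NonStrictToStrict _≈_ _≤_ public using (_<_)
  open Algebra.Properties.Semiring.Exp semiring public using (_^_)

module Spectral (ℝ : CompleteOrderedField ℓ) where
  open CompleteOrderedField ℝ
  open Algebra.Properties.Ring ring using (-‿distribˡ-*; -‿distribʳ-*; -‿involutive)

  private
    resp₂ : ∀ {w x y z} → w ≈ x → y ≈ z → w ≤ y → x ≤ z
    resp₂ w≈x y≈z w≤y =
      Order.≤-respˡ-≈ w≈x (Order.≤-respʳ-≈ y≈z w≤y)

    x≤0⇒0≤-x : ∀ {x} → x ≤ 0# → 0# ≤ - x
    x≤0⇒0≤-x {x} x≤0 = resp₂ (-‿inverseʳ x) (+-identityˡ (- x)) (+-monoˡ-≤ (- x) x≤0)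

    -x*-x≈x*x : ∀ x → - x * - x ≈ x * x
    -x*-x≈x*x x = trans (sym (-‿distribˡ-* x (- x)))
                 (trans (-‿cong (sym (-‿distribʳ-* x x))) (-‿involutive (x * x)))

    0≤x*x : ∀ x → 0# ≤ x * x
    0≤x*x x with Order.total 0# x
    ... | inj₁ 0≤x = *-nonNeg 0≤x 0≤x
    ... | inj₂ x≤0 = Order.≤-respʳ-≈ (-x*-x≈x*x x)
                       (*-nonNeg (x≤0⇒0≤-x x≤0) (x≤0⇒0≤-x x≤0))

    0≤1 : 0# ≤ 1#
    0≤1 = Order.≤-respʳ-≈ (*-identityʳ 1#) (0≤x*x 1#)

    0≤x⇒y≤x+y : ∀ {x} y → 0# ≤ x → y ≤ x + y
    0≤x⇒y≤x+y y 0≤x = Order.≤-respˡ-≈ (+-identityˡ y) (+-monoˡ-≤ y 0≤x)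

    +-nonNeg : ∀ {x y} → 0# ≤ x → 0# ≤ y → 0# ≤ x + y
    +-nonNeg {y = y} 0≤x 0≤y = Order.trans 0≤y (0≤x⇒y≤x+y y 0≤x)

    1≤y⇒y≤y*y : ∀ {y} → 1# ≤ y → y ≤ y * y
    1≤y⇒y≤y*y {y} 1≤y = resp₂ (+-identityˡ y) lemma (+-monoˡ-≤ y (*-nonNeg 0≤y-1 0≤y))
      where
      0≤y-1 : 0# ≤ y + - 1#
      0≤y-1 = Order.≤-respˡ-≈ (-‿inverseʳ 1#) (+-monoˡ-≤ (- 1#) 1≤y)
      0≤y : 0# ≤ y
      0≤y = Order.trans 0≤1 1≤y
      open Relation.Binary.Reasoning.Setoid setoid
      lemma : (y + - 1#) * y + y ≈ y * y
      lemma = begin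
        (y + - 1#) * y + y       ≈⟨ +-congˡ (*-identityˡ y) ⟨
        (y + - 1#) * y + 1# * y  ≈⟨ distribʳ y (y + - 1#) 1# ⟨
        (y + - 1# + 1#) * y      ≈⟨ *-congʳ (+-assoc y (- 1#) 1#) ⟩
        (y + (- 1# + 1#)) * y    ≈⟨ *-congʳ (+-congˡ (-‿inverseˡ 1#)) ⟩
        (y + 0#) * y             ≈⟨ *-congʳ (+-identityʳ y) ⟩
        y * y                    ∎

    y*y≤x⇒y≤x+1 : ∀ {x} → 0# ≤ x → ∀ y → y * y ≤ x → y ≤ x + 1#
    y*y≤x⇒y≤x+1 {x} 0≤x y y²≤x with Order.total 1# y
    ... | inj₂ y≤1 = Order.trans y≤1 (0≤x⇒y≤x+y 1# 0≤x)
    ... | inj₁ 1≤y = Order.trans (1≤y⇒y≤y*y 1≤y) (Order.trans y²≤x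
                       (Order.≤-respʳ-≈ (+-comm 1# x) (0≤x⇒y≤x+y x 0≤1)))

  -- √x = sup { y | y² ≤ x }
  √-sup : ∀ x → 0# ≤ x → ∃[ s ] IsSupremum (λ y → y * y ≤ x) s
  √-sup x 0≤x = complete (λ y → y * y ≤ x)
    (0# , Order.≤-respˡ-≈ (sym (zeroˡ 0#)) 0≤x)
    (x + 1# , y*y≤x⇒y≤x+1 0≤x)

  √ : ∀ x → 0# ≤ x → Carrier
  √ x 0≤x = proj₁ (√-sup x 0≤x)

  infix  8 _+i_
  infixl 7 _*ℂ_
  infixl 6 _+ℂ_
  infix  4 _≈ℂ_

  record ℂ : Set ℓ where
    constructor _+i_
    field
      re im : Carrier
  open ℂ public

  _≈ℂ_ : Rel ℂ ℓ
  z ≈ℂ w = re z ≈ re w × im z ≈ im w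

  _+ℂ_ : ℂ → ℂ → ℂ
  z +ℂ w = (re z + re w) +i (im z + im w)

  _*ℂ_ : ℂ → ℂ → ℂ
  z *ℂ w = (re z * re w - im z * im w) +i (re z * im w + im z * re w)

  ofReal : Carrier → ℂ
  ofReal x = x +i 0#

  +ℂ-rawMonoid : RawMonoid ℓ ℓ
  +ℂ-rawMonoid = record { Carrier = ℂ ; _≈_ = _≈ℂ_ ; _∙_ = _+ℂ_ ; ε = ofReal 0# }

  open Algebra.Definitions.RawMonoid +ℂ-rawMonoid public using () renaming (sum to sumℂ)

  ∣_∣ : ℂ → Carrier
  ∣ z ∣ = √ (re z * re z + im z * im z) (+-nonNeg (0≤x*x (re z)) (0≤x*x (im z)))

  Matrix : ℕ → Set ℓ
  Matrix n = Fin n → Fin n → Carrier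

  IsEigenvector : ∀ {n} → Matrix n → ℂ → Vector ℂ n → Set ℓ
  IsEigenvector M μ v =
    ¬ (∀ i → v i ≈ℂ ofReal 0#) ×
    (∀ i → sumℂ (λ j → ofReal (M i j) *ℂ v j) ≈ℂ μ *ℂ v i)

  IsEigenvalue : ∀ {n} → Matrix n → ℂ → Set ℓ
  IsEigenvalue M μ = ∃[ v ] IsEigenvector M μ v

  -- ρ = max { ∣μ∣ | μ an eigenvalue of M }; this determines ρ up to _≈_.
  IsSpectralRadius : ∀ {n} → Matrix n → Carrier → Set ℓ
  IsSpectralRadius M ρ =
    (∃[ μ ] IsEigenvalue M μ × ∣ μ ∣ ≈ ρ) ×
    (∀ μ → IsEigenvalue M μ → ∣ μ ∣ ≤ ρ)

  -- Rows and columns are numbered from 0, so with i = 0, …, h-2 the entries at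
  -- (i , i+1) and (i+1 , i) are r^(i/2) = (√r)^i.
  A : (h : ℕ) (r : Carrier) → 0# < r → Matrix h
  A h r (0≤r , _) i j with toℕ j ℕₚ.≟ suc (toℕ i) | toℕ i ℕₚ.≟ suc (toℕ j)
  ... | yes _ | _     = √ r 0≤r ^ toℕ i
  ... | no _  | yes _ = √ r 0≤r ^ toℕ j
  ... | no _  | no _  = 0#

{-# OPTIONS --safe #-}
-- A_h is the weighted path W on h + 1 vertices with one end vertex deleted;
-- let L and R be W without its last, respectively first vertex, and M = L ∩ R.
-- Up to the factor √r, the block R is a copy of L = A_h and M is a copy of
-- A_(h-1), so the claim is ρ(W) ρ(M) ≤ ρ(L) ρ(R), which holds for all positive
-- weights: two walks on the path whose positions have the same parity cannot
-- cross without meeting, and swapping their tails at a meeting turns a pair of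
-- walks in (W , M) into a pair in (L , R).  In terms of Perron vectors w, z, u, y
-- of W, M, L, R and κ > 0, this becomes the invariance of the inequalities
--   κ w_i z_j ≤ u_i y_j,   κ z_i w_j ≤ u_i y_j,
--   κ (w_i z_j + z_i w_j) ≤ u_i y_j + y_i u_j    (i ≤ j, j - i even)
-- under one step of both walks.  A step multiplies the left-hand sides by
-- ρ(W) ρ(M) and the right-hand sides by ρ(L) ρ(R), so κ could be increased
-- indefinitely if ρ(W) ρ(M) > ρ(L) ρ(R).
-- The same scaling argument shows that an eigenvalue with a positive
-- eigenvector on the path dominates the modulus of all complex eigenvalues.
-- Such an eigenvector is given by the orthogonal polynomials of the path at
-- the supremum of the points where one of them is ≤ 0.
module Submission where

open import Defs
import Algebra.Properties.AbelianGroup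
import Algebra.Properties.CommutativeMonoid.Sum
import Algebra.Properties.Ring
import Algebra.Properties.Semiring.Mult.TCOptimised
import Algebra.Solver.Ring
import Algebra.Solver.Ring.AlmostCommutativeRing as ACR
open import Algebra.Bundles using (CommutativeRing; RawRing)
open import Data.Fin.Base as Fin using (Fin; toℕ; fromℕ<)
import Data.Fin.Properties as Finₚ
open import Data.Integer.Base as ℤ using (ℤ; +_; -[1+_])
import Data.Integer.Properties as ℤₚ
open import Data.Maybe.Base using (Maybe; just; nothing)
open import Data.Nat.Base as ℕ using (ℕ; zero; suc; s≤s; z≤n; s≤s⁻¹; _∸_)
import Data.Nat.Properties as ℕₚ
open import Data.Product.Base using (∃-syntax; _×_; _,_; proj₁; proj₂)
open import Data.Sum.Base using (_⊎_; inj₁; inj₂)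
open import Data.Unit.Base using (⊤)
open import Data.Vec.Functional using (Vector)
open import Function.Base using (_∘_)
open import Relation.Binary.Bundles using (DecTotalOrder)
open import Relation.Binary.PropositionalEquality.Core as ≡ using (_≡_; _≢_)
import Relation.Binary.Properties.DecTotalOrder
import Relation.Binary.Reasoning.PartialOrder
import Relation.Binary.Reasoning.Setoid
open import Relation.Nullary.Decidable using (Dec; yes; no)
open import Relation.Nullary.Negation using (¬_; contradiction)

-- A ring solver with integer coefficients.

module IntegerCoefficients {c ℓ} (R : CommutativeRing c ℓ) where
  open CommutativeRing R
  open Algebra.Properties.Ring ring using (-‿distribˡ-*; -‿distribʳ-*; -‿involutive; -0#≈0#)
  open Algebra.Properties.AbelianGroup +-abelianGroup using (⁻¹-∙-comm)
  open Algebra.Properties.Semiring.Mult.TCOptimised semiring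
    using (1+×; ×-homo-+; ×1-homo-*) renaming (_×_ to _×′_)
  open Relation.Binary.Reasoning.Setoid setoid

  ⟦_⟧ : ℤ → Carrier
  ⟦ + n ⟧      = n ×′ 1#
  ⟦ -[1+ n ] ⟧ = - (suc n ×′ 1#)

  -‿homo : ∀ i → ⟦ ℤ.- i ⟧ ≈ - ⟦ i ⟧
  -‿homo (+ zero)  = sym -0#≈0#
  -‿homo (+ suc n) = refl
  -‿homo -[1+ n ]  = sym (-‿involutive _)

  ⊖-homo : ∀ m n → ⟦ m ℤ.⊖ n ⟧ ≈ m ×′ 1# - n ×′ 1#
  ⊖-homo m zero = sym (trans (+-congˡ -0#≈0#) (+-identityʳ _))
  ⊖-homo zero (suc n) = sym (+-identityˡ _)
  ⊖-homo (suc m) (suc n) = begin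
    ⟦ suc m ℤ.⊖ suc n ⟧                   ≡⟨ ≡.cong ⟦_⟧ (ℤₚ.[1+m]⊖[1+n]≡m⊖n m n) ⟩
    ⟦ m ℤ.⊖ n ⟧                           ≈⟨ ⊖-homo m n ⟩
    m ×′ 1# - n ×′ 1#                       ≈⟨ +-congʳ (+-identityʳ _) ⟨
    m ×′ 1# + 0# - n ×′ 1#                  ≈⟨ +-congʳ (+-congˡ (-‿inverseʳ 1#)) ⟨
    m ×′ 1# + (1# - 1#) - n ×′ 1#           ≈⟨ +-congʳ (+-assoc _ _ _) ⟨
    m ×′ 1# + 1# - 1# - n ×′ 1#             ≈⟨ +-congʳ (+-congʳ (+-comm _ _)) ⟩
    1# + m ×′ 1# - 1# - n ×′ 1#             ≈⟨ +-assoc _ _ _ ⟩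
    1# + m ×′ 1# + (- 1# - n ×′ 1#)         ≈⟨ +-congˡ (⁻¹-∙-comm _ _) ⟩
    1# + m ×′ 1# - (1# + n ×′ 1#)           ≈⟨ +-cong (1+× m 1#) (-‿cong (1+× n 1#)) ⟨
    suc m ×′ 1# - suc n ×′ 1#               ∎

  +-homo : ∀ i j → ⟦ i ℤ.+ j ⟧ ≈ ⟦ i ⟧ + ⟦ j ⟧
  +-homo (+ m)    (+ n)    = ×-homo-+ 1# m n
  +-homo (+ m)    -[1+ n ] = ⊖-homo m (suc n)
  +-homo -[1+ m ] (+ n)    = trans (⊖-homo n (suc m)) (+-comm _ _)
  +-homo -[1+ m ] -[1+ n ] = begin
    - (suc (suc (m ℕ.+ n)) ×′ 1#)      ≡⟨ ≡.cong (λ k → - (suc k ×′ 1#)) (≡.sym (ℕₚ.+-suc m n)) ⟩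
    - ((suc m ℕ.+ suc n) ×′ 1#)        ≈⟨ -‿cong (×-homo-+ 1# (suc m) (suc n)) ⟩
    - (suc m ×′ 1# + suc n ×′ 1#)       ≈⟨ ⁻¹-∙-comm _ _ ⟨
    - (suc m ×′ 1#) - suc n ×′ 1#       ∎

  -- Transfers multiplicativity from `i` to its negative, so that only non-negative left factors
  -- need a direct argument.
  *-homo-neg : ∀ i j → ⟦ i ℤ.* j ⟧ ≈ ⟦ i ⟧ * ⟦ j ⟧ → ⟦ ℤ.- i ℤ.* j ⟧ ≈ ⟦ ℤ.- i ⟧ * ⟦ j ⟧
  *-homo-neg i j eq = begin
    ⟦ ℤ.- i ℤ.* j ⟧       ≡⟨ ≡.cong ⟦_⟧ (≡.sym (ℤₚ.neg-distribˡ-* i j)) ⟩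
    ⟦ ℤ.- (i ℤ.* j) ⟧     ≈⟨ -‿homo (i ℤ.* j) ⟩
    - ⟦ i ℤ.* j ⟧         ≈⟨ -‿cong eq ⟩
    - (⟦ i ⟧ * ⟦ j ⟧)     ≈⟨ -‿distribˡ-* _ _ ⟩
    - ⟦ i ⟧ * ⟦ j ⟧       ≈⟨ *-congʳ (-‿homo i) ⟨
    ⟦ ℤ.- i ⟧ * ⟦ j ⟧     ∎

  *-homo⁺ : ∀ m j → ⟦ + m ℤ.* j ⟧ ≈ ⟦ + m ⟧ * ⟦ j ⟧
  *-homo⁺ m (+ n) = trans (reflexive (≡.cong ⟦_⟧ (≡.sym (ℤₚ.pos-* m n)))) (×1-homo-* m n)
  -- Commuting moves the negative factor to the left, where `*-homo-neg` reduces it to the previous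
  -- clause.
  *-homo⁺ m -[1+ n ] = begin
    ⟦ + m ℤ.* -[1+ n ] ⟧     ≡⟨ ≡.cong ⟦_⟧ (ℤₚ.*-comm (+ m) -[1+ n ]) ⟩
    ⟦ -[1+ n ] ℤ.* + m ⟧     ≈⟨ *-homo-neg (+ suc n) (+ m) (*-homo⁺ (suc n) (+ m)) ⟩
    ⟦ -[1+ n ] ⟧ * ⟦ + m ⟧   ≈⟨ *-comm _ _ ⟩
    ⟦ + m ⟧ * ⟦ -[1+ n ] ⟧   ∎

  *-homo : ∀ i j → ⟦ i ℤ.* j ⟧ ≈ ⟦ i ⟧ * ⟦ j ⟧
  *-homo (+ m)    j = *-homo⁺ m j
  *-homo -[1+ m ] j = *-homo-neg (+ suc m) j (*-homo⁺ (suc m) j)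

  almostCommutativeRing : ACR.AlmostCommutativeRing c ℓ
  almostCommutativeRing = ACR.fromCommutativeRing R

  ℤ-rawRing : RawRing _ _
  ℤ-rawRing = CommutativeRing.rawRing ℤₚ.+-*-commutativeRing

  ℤ⟶R : ℤ-rawRing ACR.-Raw-AlmostCommutative⟶ almostCommutativeRing
  ℤ⟶R = record
    { ⟦_⟧ = ⟦_⟧ ; +-homo = +-homo ; *-homo = *-homo ; -‿homo = -‿homo
    ; 0-homo = refl ; 1-homo = refl }

  -- Coefficients are compared as integers, where equality computes; in an abstract ring it would
  -- not, and normal forms could not cancel.
  _coeff≟_ : ∀ i j → Maybe (⟦ i ⟧ ≈ ⟦ j ⟧)
  i coeff≟ j with i ℤₚ.≟ j
  ... | yes ≡.refl = just refl
  ... | no _       = nothing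

  open Algebra.Solver.Ring ℤ-rawRing almostCommutativeRing ℤ⟶R _coeff≟_ public
    using (solve; _:=_; _:+_; _:*_; _:-_; :-_; con)

-- Arithmetic of ordered fields.

module OrderedField {ℓ} (ℝ : CompleteOrderedField ℓ) where
  open CompleteOrderedField ℝ public
  open Algebra.Properties.Ring ring public using (-‿involutive; -0#≈0#)
  open IntegerCoefficients commutativeRing public
    using (solve; _:=_; _:+_; _:*_; _:-_; :-_; con)

  decTotalOrder : DecTotalOrder ℓ ℓ ℓ
  decTotalOrder = record { isDecTotalOrder = isDecTotalOrder }

  open Relation.Binary.Properties.DecTotalOrder decTotalOrder public
    using (≰⇒>; <⇒≱)

  module ≤-Reasoning = Relation.Binary.Reasoning.PartialOrder (DecTotalOrder.poset decTotalOrder)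
  open ≤-Reasoning

  ≤-refl : ∀ {x} → x ≤ x
  ≤-refl = Order.reflexive refl

  ≤-<-connex : ∀ x y → x ≤ y ⊎ y < x
  ≤-<-connex x y with x Order.≤? y
  ... | yes x≤y = inj₁ x≤y
  ... | no x≰y  = inj₂ (≰⇒> x≰y)

  <-respʳ-≈ : ∀ {x y z} → y ≈ z → x < y → x < z
  <-respʳ-≈ y≈z (x≤y , x≉y) = Order.≤-respʳ-≈ y≈z x≤y , λ x≈z → x≉y (trans x≈z (sym y≈z))

  x≤y⇒0≤y-x : ∀ {x y} → x ≤ y → 0# ≤ y - x
  x≤y⇒0≤y-x {x} {y} x≤y = begin
    0#    ≈⟨ -‿inverseʳ x ⟨
    x - x ≤⟨ +-monoˡ-≤ (- x) x≤y ⟩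
    y - x ∎

  0≤y-x⇒x≤y : ∀ {x y} → 0# ≤ y - x → x ≤ y
  0≤y-x⇒x≤y {x} {y} 0≤y-x = begin
    x          ≈⟨ +-identityˡ x ⟨
    0# + x     ≤⟨ +-monoˡ-≤ x 0≤y-x ⟩
    y - x + x  ≈⟨ solve 2 (λ x y → y :- x :+ x := y) refl x y ⟩
    y          ∎

  +-mono-≤ : ∀ {x y u v} → x ≤ y → u ≤ v → x + u ≤ y + v
  +-mono-≤ {x} {y} {u} {v} x≤y u≤v = begin
    x + u ≤⟨ +-monoˡ-≤ u x≤y ⟩
    y + u ≈⟨ +-comm y u ⟩
    u + y ≤⟨ +-monoˡ-≤ y u≤v ⟩
    v + y ≈⟨ +-comm v y ⟩
    y + v ∎

  +-nonNeg : ∀ {x y} → 0# ≤ x → 0# ≤ y → 0# ≤ x + y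
  +-nonNeg 0≤x 0≤y = Order.≤-respˡ-≈ (+-identityˡ 0#) (+-mono-≤ 0≤x 0≤y)

  *-monoˡ-≤ : ∀ {x y z} → 0# ≤ z → x ≤ y → z * x ≤ z * y
  *-monoˡ-≤ {x} {y} {z} 0≤z x≤y = 0≤y-x⇒x≤y (Order.≤-respʳ-≈
    (solve 3 (λ x y z → z :* (y :- x) := z :* y :- z :* x) refl x y z)
    (*-nonNeg 0≤z (x≤y⇒0≤y-x x≤y)))

  *-monoʳ-≤ : ∀ {x y z} → 0# ≤ z → x ≤ y → x * z ≤ y * z
  *-monoʳ-≤ {x} {y} {z} 0≤z x≤y = begin
    x * z ≈⟨ *-comm x z ⟩
    z * x ≤⟨ *-monoˡ-≤ 0≤z x≤y ⟩
    z * y ≈⟨ *-comm z y ⟩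
    y * z ∎

  *-mono-≤ : ∀ {x y u v} → 0# ≤ x → 0# ≤ v → x ≤ y → u ≤ v → x * u ≤ y * v
  *-mono-≤ 0≤x 0≤v x≤y u≤v = Order.trans (*-monoˡ-≤ 0≤x u≤v) (*-monoʳ-≤ 0≤v x≤y)

  x*x-nonNeg : ∀ x → 0# ≤ x * x
  x*x-nonNeg x with Order.total 0# x
  ... | inj₁ 0≤x = *-nonNeg 0≤x 0≤x
  ... | inj₂ x≤0 = Order.≤-respʳ-≈
    (solve 1 (λ x → (con (+ 0) :- x) :* (con (+ 0) :- x) := x :* x) refl x)
    (*-nonNeg (x≤y⇒0≤y-x x≤0) (x≤y⇒0≤y-x x≤0))

  0<1 : 0# < 1#
  0<1 = Order.≤-respʳ-≈ (*-identityʳ 1#) (x*x-nonNeg 1#) , 0≉1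

  x*y≈0⇒y≈0 : ∀ {x y} → ¬ x ≈ 0# → x * y ≈ 0# → y ≈ 0#
  x*y≈0⇒y≈0 {x} {y} x≉0 xy≈0 with invertible x x≉0
  ... | x⁻¹ , x⁻¹*x≈1 , _ = begin-equality
    y              ≈⟨ *-identityˡ y ⟨
    1# * y         ≈⟨ *-congʳ x⁻¹*x≈1 ⟨
    x⁻¹ * x * y    ≈⟨ *-assoc x⁻¹ x y ⟩
    x⁻¹ * (x * y)  ≈⟨ *-congˡ xy≈0 ⟩
    x⁻¹ * 0#       ≈⟨ zeroʳ x⁻¹ ⟩
    0#             ∎

  *-pos : ∀ {x y} → 0# < x → 0# < y → 0# < x * y
  *-pos (0≤x , 0≉x) (0≤y , 0≉y) = *-nonNeg 0≤x 0≤y ,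
    λ 0≈xy → 0≉y (sym (x*y≈0⇒y≈0 (0≉x ∘ sym) (sym 0≈xy)))

  -- If `y < x`, monotonicity forces `z * x ≈ z * y`, and since there are no zero divisors `x - y`
  -- vanishes.
  *-cancelˡ-≤ : ∀ {x y z} → 0# < z → z * x ≤ z * y → x ≤ y
  *-cancelˡ-≤ {x} {y} {z} 0<z zx≤zy with ≤-<-connex x y
  ... | inj₁ x≤y = x≤y
  ... | inj₂ (y≤x , y≉x) = contradiction
      (x*y≈0⇒y≈0 (proj₂ 0<z ∘ sym) (trans
        (solve 3 (λ x y z → z :* (x :- y) := z :* x :- z :* y) refl x y z)
        (trans (+-congʳ (Order.antisym zx≤zy (*-monoˡ-≤ (proj₁ 0<z) y≤x))) (-‿inverseʳ _))))
      (λ x-y≈0 → y≉x (begin-equality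
        y          ≈⟨ +-identityˡ y ⟨
        0# + y     ≈⟨ +-congʳ x-y≈0 ⟨
        x - y + y  ≈⟨ solve 2 (λ x y → x :- y :+ y := x) refl x y ⟩
        x          ∎))

  +-pos-nonNeg : ∀ {x y} → 0# < x → 0# ≤ y → 0# < x + y
  +-pos-nonNeg {x} {y} 0<x 0≤y = begin-strict
    0#     <⟨ 0<x ⟩
    x      ≈⟨ +-identityʳ x ⟨
    x + 0# ≤⟨ +-mono-≤ ≤-refl 0≤y ⟩
    x + y  ∎

  reciprocal : ∀ {x} → 0# < x → ∃[ y ] 0# < y × x * y ≈ 1#
  reciprocal {x} 0<x@(0≤x , 0≉x) with invertible x (0≉x ∘ sym)
  ... | y , _ , xy≈1 = y , (*-cancelˡ-≤ 0<x (begin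
      x * 0# ≈⟨ zeroʳ x ⟩
      0#     ≤⟨ proj₁ 0<1 ⟩
      1#     ≈⟨ xy≈1 ⟨
      x * y  ∎)
    , λ 0≈y → 0≉1 (begin-equality
      0#     ≈⟨ zeroʳ x ⟨
      x * 0# ≈⟨ *-congˡ 0≈y ⟩
      x * y  ≈⟨ xy≈1 ⟩
      1#     ∎)) , xy≈1

  -- If `y < x`, then `x * x ≤ y * y ≤ x * y`, and the positive `x` cancels.
  square-cancel-≤ : ∀ {x y} → 0# ≤ y → x * x ≤ y * y → x ≤ y
  square-cancel-≤ {x} {y} 0≤y x²≤y² with ≤-<-connex x y
  ... | inj₁ x≤y = x≤y
  ... | inj₂ y<x = *-cancelˡ-≤ (begin-strict 0# ≤⟨ 0≤y ⟩ y <⟨ y<x ⟩ x ∎) (begin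
    x * x ≤⟨ x²≤y² ⟩
    y * y ≤⟨ *-monoʳ-≤ 0≤y (proj₁ y<x) ⟩
    x * y ∎)

  x≤y⇒-y≤-x : ∀ {x y} → x ≤ y → - y ≤ - x
  x≤y⇒-y≤-x {x} {y} x≤y = 0≤y-x⇒x≤y (Order.≤-respʳ-≈
    (solve 2 (λ x y → y :- x := :- x :- (:- y)) refl x y) (x≤y⇒0≤y-x x≤y))

  +-cancelˡ-≤ : ∀ z {x y} → z + x ≤ z + y → x ≤ y
  +-cancelˡ-≤ z {x} {y} zx≤zy = 0≤y-x⇒x≤y (Order.≤-respʳ-≈
    (solve 3 (λ x y z → z :+ y :- (z :+ x) := y :- x) refl x y z) (x≤y⇒0≤y-x zx≤zy))

  square≤0⇒≈0 : ∀ {x} → x * x ≤ 0# → x ≈ 0#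
  square≤0⇒≈0 {x} x²≤0 with x Order.≟ 0#
  ... | yes x≈0 = x≈0
  ... | no x≉0  = x*y≈0⇒y≈0 x≉0 (Order.antisym x²≤0 (x*x-nonNeg x))

  x²≤x²+y² : ∀ x y → x * x ≤ x * x + y * y
  x²≤x²+y² x y = Order.≤-respˡ-≈ (+-identityʳ _) (+-mono-≤ ≤-refl (x*x-nonNeg y))

  0<2 : 0# < 1# + 1#
  0<2 = +-pos-nonNeg 0<1 (proj₁ 0<1)

  half : ∀ {x} → 0# < x → ∃[ y ] 0# < y × y + y ≈ x
  half {x} 0<x = let (½ , 0<½ , 2½≈1) = reciprocal 0<2 in x * ½ , *-pos 0<x 0<½ , (begin-equality
    x * ½ + x * ½       ≈⟨ solve 2 (λ x h → x :* h :+ x :* h := x :* ((con (+ 1) :+ con (+ 1)) :* h)) refl x ½ ⟩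
    x * ((1# + 1#) * ½) ≈⟨ *-congˡ 2½≈1 ⟩
    x * 1#              ≈⟨ *-identityʳ x ⟩
    x                   ∎)

  common-half : ∀ {x y} → 0# < x → 0# < y → ∃[ z ] 0# < z × z + z ≤ x × z + z ≤ y
  common-half {x} {y} 0<x 0<y with Order.total x y
  ... | inj₁ x≤y = let (z , 0<z , 2z≈x) = half 0<x in
    z , 0<z , Order.reflexive 2z≈x , Order.trans (Order.reflexive 2z≈x) x≤y
  ... | inj₂ y≤x = let (z , 0<z , 2z≈y) = half 0<y in
    z , 0<z , Order.trans (Order.reflexive 2z≈y) y≤x , Order.reflexive 2z≈y

  -- The conditions persist for smaller positive numbers, so the minimum of finitely many witnesses
  -- satisfies all of them. This yields common scaling constants and common neighbourhoods.
  common-lower-bound : (_R_ : ℕ → Carrier → Set ℓ) →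
    (∀ {k x y} → 0# < x → x ≤ y → k R y → k R x) →
    ∀ n → (∀ k → k ℕ.< n → ∃[ x ] 0# < x × k R x) →
    ∃[ x ] 0# < x × (∀ k → k ℕ.< n → k R x)
  common-lower-bound _R_ down zero _ = 1# , 0<1 , λ _ ()
  common-lower-bound _R_ down (suc n) each
    with common-lower-bound _R_ down n (λ k k<n → each k (ℕₚ.m<n⇒m<1+n k<n))
       | each n (ℕₚ.n<1+n n)
  ... | x , 0<x , all | y , 0<y , nRy with Order.total x y
  ...   | inj₁ x≤y = x , 0<x , λ k k<1+n → below k (ℕₚ.m<1+n⇒m<n∨m≡n k<1+n)
    where
    below : ∀ k → k ℕ.< n ⊎ k ≡ n → k R x
    below k (inj₁ k<n)    = all k k<n
    below k (inj₂ ≡.refl) = down 0<x x≤y nRy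
  ...   | inj₂ y≤x = y , 0<y , λ k k<1+n → below k (ℕₚ.m<1+n⇒m<n∨m≡n k<1+n)
    where
    below : ∀ k → k ℕ.< n ⊎ k ≡ n → k R y
    below k (inj₁ k<n)    = down 0<y y≤x (all k k<n)
    below k (inj₂ ≡.refl) = nRy

  -- For the supremum s of all κ > 0 with κ X ≤ Y, the hypothesis gives
  -- s T ≤ s S.
  contraction : ∀ {I : Set} (X Y : I → Carrier) {S T} → 0# ≤ S →
    ∃[ κ ] 0# < κ × (∀ i → κ * X i ≤ Y i) →
    (∀ κ → 0# < κ → (∀ i → κ * X i ≤ Y i) → ∀ i → κ * (T * X i) ≤ S * Y i) →
    ¬ (∀ i → X i ≤ 0#) → T ≤ S
  contraction {I} X Y {S} {T} 0≤S (κ₀ , 0<κ₀ , κ₀X≤Y) step X≰0 with ≤-<-connex T S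
  ... | inj₁ T≤S = T≤S
  ... | inj₂ S<T = contradiction X≤0 X≰0
    where
    0<T : 0# < T
    0<T = begin-strict 0# ≤⟨ 0≤S ⟩ S <⟨ S<T ⟩ T ∎

    P : Carrier → Set ℓ
    P κ = 0# < κ × (∀ i → κ * X i ≤ Y i)

    X≤0 : ∀ i → X i ≤ 0#
    X≤0 i with ≤-<-connex (X i) 0#
    ... | inj₁ Xᵢ≤0 = Xᵢ≤0
    ... | inj₂ 0<Xᵢ with S Order.≟ 0#
    -- Division by `S` is impossible here, but a single step already gives `κ₀ * (T * X i) ≤ 0`.
    ...   | yes S≈0 = *-cancelˡ-≤ 0<κ₀ (*-cancelˡ-≤ 0<T (begin
      T * (κ₀ * X i)  ≈⟨ solve 3 (λ t κ x → t :* (κ :* x) := κ :* (t :* x)) refl T κ₀ (X i) ⟩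
      κ₀ * (T * X i)  ≤⟨ step κ₀ 0<κ₀ κ₀X≤Y i ⟩
      S * Y i         ≈⟨ *-congʳ S≈0 ⟩
      0# * Y i        ≈⟨ solve 3 (λ t κ y → con (+ 0) :* y := t :* (κ :* con (+ 0))) refl T κ₀ (Y i) ⟩
      T * (κ₀ * 0#)   ∎))
    ...   | no S≉0 = contradiction (*-cancelˡ-≤ 0<s sT≤sS) (<⇒≱ S<T)
      where
      0<S : 0# < S
      0<S = 0≤S , S≉0 ∘ sym

      bounded : ∃[ u ] IsUpperBound P u
      bounded with reciprocal 0<Xᵢ
      -- Since `w` inverts `X i`, every admissible `κ` is at most the quotient of `Y i` by `X i`.
      ... | w , 0<w , Xw≈1 = Y i * w , λ κ (_ , κX≤Y) → begin
        κ              ≈⟨ *-identityʳ κ ⟨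
        κ * 1#         ≈⟨ *-congˡ Xw≈1 ⟨
        κ * (X i * w)  ≈⟨ *-assoc κ (X i) w ⟨
        κ * X i * w    ≤⟨ *-monoʳ-≤ (proj₁ 0<w) (κX≤Y i) ⟩
        Y i * w        ∎

      sup : ∃[ s ] IsSupremum P s
      sup = complete P (κ₀ , 0<κ₀ , κ₀X≤Y) bounded
      s = proj₁ sup

      0<s : 0# < s
      0<s = begin-strict 0# <⟨ 0<κ₀ ⟩ κ₀ ≤⟨ proj₁ (proj₂ sup) κ₀ (0<κ₀ , κ₀X≤Y) ⟩ s ∎

      sT≤sS′ : ∃[ S⁻¹ ] 0# < S⁻¹ × S * S⁻¹ ≈ 1# → ∃[ T⁻¹ ] 0# < T⁻¹ × T * T⁻¹ ≈ 1# →
               s * T ≤ s * S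
      sT≤sS′ (S⁻¹ , 0<S⁻¹ , SS⁻¹≈1) (T⁻¹ , 0<T⁻¹ , TT⁻¹≈1) = begin
        s * T              ≤⟨ *-monoʳ-≤ (proj₁ 0<T) (proj₂ (proj₂ sup) (s * S * T⁻¹) κ≤sS/T) ⟩
        s * S * T⁻¹ * T    ≈⟨ solve 3 (λ a b c → a :* b :* c := a :* (c :* b)) refl (s * S) T⁻¹ T ⟩
        s * S * (T * T⁻¹)  ≈⟨ *-congˡ TT⁻¹≈1 ⟩
        s * S * 1#         ≈⟨ *-identityʳ _ ⟩
        s * S              ∎
        where
        -- Dividing the step by `S` shows that κ T / S is admissible along with κ, hence at most s.
        -- So s S / T is an upper bound too, and leastness gives s ≤ s S / T.
        scaled : ∀ κ → P κ → P (κ * T * S⁻¹)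
        scaled κ (0<κ , κX≤Y) = *-pos (*-pos 0<κ 0<T) 0<S⁻¹ , λ j → begin
          κ * T * S⁻¹ * X j      ≈⟨ solve 4 (λ κ t s x → κ :* t :* s :* x := κ :* (t :* x) :* s) refl κ T S⁻¹ (X j) ⟩
          κ * (T * X j) * S⁻¹    ≤⟨ *-monoʳ-≤ (proj₁ 0<S⁻¹) (step κ 0<κ κX≤Y j) ⟩
          S * Y j * S⁻¹          ≈⟨ solve 3 (λ s y r → s :* y :* r := s :* r :* y) refl S (Y j) S⁻¹ ⟩
          S * S⁻¹ * Y j          ≈⟨ *-congʳ SS⁻¹≈1 ⟩
          1# * Y j               ≈⟨ *-identityˡ _ ⟩
          Y j                    ∎

        κ≤sS/T : IsUpperBound P (s * S * T⁻¹)
        κ≤sS/T κ Pκ = begin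
          κ                                    ≈⟨ *-identityʳ κ ⟨
          κ * 1#                               ≈⟨ *-identityʳ _ ⟨
          κ * 1# * 1#                          ≈⟨ *-cong (*-congˡ TT⁻¹≈1) SS⁻¹≈1 ⟨
          κ * (T * T⁻¹) * (S * S⁻¹)            ≈⟨ solve 5 (λ κ t t′ s s′ → κ :* (t :* t′) :* (s :* s′) := κ :* t :* s′ :* (s :* t′)) refl κ T T⁻¹ S S⁻¹ ⟩
          κ * T * S⁻¹ * (S * T⁻¹)              ≤⟨ *-monoʳ-≤ (*-nonNeg 0≤S (proj₁ 0<T⁻¹)) (proj₁ (proj₂ sup) _ (scaled κ Pκ)) ⟩
          s * (S * T⁻¹)                        ≈⟨ *-assoc s S T⁻¹ ⟨
          s * S * T⁻¹                          ∎

      sT≤sS : s * T ≤ s * S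
      sT≤sS = sT≤sS′ (reciprocal 0<S) (reciprocal 0<T)

-- i ⊴ j: i ≤ j and j - i is even.
infix 4 _⊴_
data _⊴_ : ℕ → ℕ → Set where
  diag  : ∀ {i} → i ⊴ i
  widen : ∀ {i j} → i ⊴ j → i ⊴ 2 ℕ.+ j

⊴⇒≤ : ∀ {i j} → i ⊴ j → i ℕ.≤ j
⊴⇒≤ diag      = ℕₚ.≤-refl
⊴⇒≤ (widen p) = ℕₚ.m≤n⇒m≤1+n (ℕₚ.m≤n⇒m≤1+n (⊴⇒≤ p))

⊴-suc : ∀ {i j} → i ⊴ j → suc i ⊴ suc j
⊴-suc diag      = diag
⊴-suc (widen p) = widen (⊴-suc p)

⊴-pred : ∀ {i j} → suc i ⊴ suc j → i ⊴ j
⊴-pred diag                      = diag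
⊴-pred (widen {j = suc j} p)     = widen (⊴-pred p)

-- Perron vectors on segments of a weighted path.

module Path {ℓ} (ℝ : CompleteOrderedField ℓ) where
  open OrderedField ℝ
  open ≤-Reasoning

  -- The weighted adjacency operator applied to `x`, evaluated at vertex `k + 1`; the offset makes
  -- `k` the left neighbour without subtraction.
  neighbourSum : (a x : ℕ → Carrier) → ℕ → Carrier
  neighbourSum a x k = a k * x k + a (suc k) * x (2 ℕ.+ k)

  -- The path has an edge of weight a k between the vertices k and k + 1; the
  -- vector x lives on the segment lo < k ≤ hi.
  record IsPerronVector (a : ℕ → Carrier) (lo hi : ℕ) (t : Carrier) (x : ℕ → Carrier) : Set ℓ where
    field
      positive : ∀ {k} → lo ℕ.< k → k ℕ.≤ hi → 0# < x k
      below    : ∀ {k} → k ℕ.≤ lo → x k ≈ 0#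
      above    : ∀ {k} → hi ℕ.< k → x k ≈ 0#
      eigen    : ∀ {k} → lo ℕ.< suc k → suc k ℕ.≤ hi → neighbourSum a x k ≈ t * x (suc k)

    nonNeg : ∀ k → 0# ≤ x k
    nonNeg k with lo ℕₚ.<? k | k ℕₚ.≤? hi
    ... | yes lo<k | yes k≤hi = proj₁ (positive lo<k k≤hi)
    ... | no lo≮k  | _        = Order.reflexive (sym (below (ℕₚ.≮⇒≥ lo≮k)))
    ... | yes _    | no k≰hi  = Order.reflexive (sym (above (ℕₚ.≰⇒> k≰hi)))

    supported : ∀ {k} → 0# < x k → lo ℕ.< k × k ℕ.≤ hi
    supported {k} (_ , 0≉x) with lo ℕₚ.<? k | k ℕₚ.≤? hi
    ... | yes lo<k | yes k≤hi = lo<k , k≤hi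
    ... | no lo≮k  | _        = contradiction (sym (below (ℕₚ.≮⇒≥ lo≮k))) 0≉x
    ... | yes _    | no k≰hi  = contradiction (sym (above (ℕₚ.≰⇒> k≰hi))) 0≉x

  neighbourSum-nonNeg : ∀ {a x} → (∀ k → 0# < a k) → (∀ k → 0# ≤ x k) → ∀ k → 0# ≤ neighbourSum a x k
  neighbourSum-nonNeg 0<a 0≤x k = +-nonNeg (*-nonNeg (proj₁ (0<a k)) (0≤x k))
                                           (*-nonNeg (proj₁ (0<a (suc k))) (0≤x (2 ℕ.+ k)))

  -- Inside the segment this is the eigenvalue equation; outside, the entry is 0 and the neighbour
  -- sum non-negative. It spares the left-hand vectors `w` and `z` a case distinction on their
  -- supports.
  subsolution : ∀ {a lo hi t x} → (∀ k → 0# < a k) → IsPerronVector a lo hi t x →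
    ∀ k → t * x (suc k) ≤ neighbourSum a x k
  subsolution {a} {lo} {hi} {t} {x} 0<a x-perron k with ≤-<-connex (x (suc k)) 0#
  ... | inj₁ x≤0 = begin
    t * x (suc k)      ≈⟨ *-congˡ (Order.antisym x≤0 (IsPerronVector.nonNeg x-perron (suc k))) ⟩
    t * 0#             ≈⟨ zeroʳ t ⟩
    0#                 ≤⟨ neighbourSum-nonNeg 0<a (IsPerronVector.nonNeg x-perron) k ⟩
    neighbourSum a x k ∎
  ... | inj₂ 0<x = let (lo<k , k≤hi) = IsPerronVector.supported x-perron 0<x in
    Order.reflexive (sym (IsPerronVector.eigen x-perron lo<k k≤hi))

  -- At the last vertex of the segment `t` times a positive entry equals a non-negative neighbour
  -- sum.
  eigenvalue-nonNeg : ∀ {a lo hi t x} → (∀ k → 0# < a k) → lo ℕ.< hi →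
    IsPerronVector a lo hi t x → 0# ≤ t
  eigenvalue-nonNeg {a} {lo} {suc hi} {t} {x} 0<a lo<hi x-perron =
    *-cancelˡ-≤ (positive lo<hi ℕₚ.≤-refl) (begin
      x (suc hi) * 0#     ≈⟨ zeroʳ _ ⟩
      0#                  ≤⟨ neighbourSum-nonNeg 0<a nonNeg hi ⟩
      neighbourSum a x hi ≈⟨ eigen lo<hi ℕₚ.≤-refl ⟩
      t * x (suc hi)      ≈⟨ *-comm t _ ⟩
      x (suc hi) * t      ∎)
    where open IsPerronVector x-perron

  -- The predicate excludes positions where `f` may be positive while `g` vanishes, as happens for
  -- `w` against `y` at vertex `l + 1`.
  Scalable : (ℕ → Set) → (f g : ℕ → Carrier) → ℕ → Set ℓ
  Scalable P f g n = ∃[ κ ] 0# < κ × (∀ k → k ℕ.< n → P k → κ * f k ≤ g k)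

  -- The quotient of `g k` by `f k` serves where both are positive, and 1 serves where `f k` is 0;
  -- finitely many such constants have a common lower bound.
  scalable : ∀ {P : ℕ → Set} {f g : ℕ → Carrier} → (∀ k → 0# ≤ f k) → (∀ k → 0# ≤ g k) →
    ∀ {n} → (∀ {k} → k ℕ.< n → P k → 0# < f k → 0# < g k) → Scalable P f g n
  scalable {P} {f} {g} 0≤f 0≤g {n} support = common-lower-bound
    (λ k κ → P k → κ * f k ≤ g k)
    (λ {k} _ κ≤κ′ κ′f≤g Pk → Order.trans (*-monoʳ-≤ (0≤f k) κ≤κ′) (κ′f≤g Pk))
    n each
    where
    each : ∀ k → k ℕ.< n → ∃[ κ ] 0# < κ × (P k → κ * f k ≤ g k)
    each k k<n with ≤-<-connex (f k) 0# | ≤-<-connex (g k) 0#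
    ... | inj₁ f≤0 | _ = 1# , 0<1 , λ _ → begin
      1# * f k ≈⟨ *-identityˡ _ ⟩
      f k      ≤⟨ f≤0 ⟩
      0#       ≤⟨ 0≤g k ⟩
      g k      ∎
    ... | inj₂ 0<f | inj₁ g≤0 = 1# , 0<1 , λ Pk → contradiction g≤0 (<⇒≱ (support k<n Pk 0<f))
    ... | inj₂ 0<f | inj₂ 0<g with reciprocal 0<f
    ...   | f⁻¹ , 0<f⁻¹ , ff⁻¹≈1 = g k * f⁻¹ , *-pos 0<g 0<f⁻¹ , λ _ → Order.reflexive (begin-equality
      g k * f⁻¹ * f k    ≈⟨ solve 3 (λ g r f → g :* r :* f := g :* (f :* r)) refl (g k) f⁻¹ (f k) ⟩
      g k * (f k * f⁻¹)  ≈⟨ *-congˡ ff⁻¹≈1 ⟩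
      g k * 1#           ≈⟨ *-identityʳ _ ⟩
      g k                ∎)

  -- Comparison of the eigenvalues of four overlapping segments.

  module Comparison {a : ℕ → Carrier} (0<a : ∀ k → 0# < a k)
    {l h : ℕ} (nonempty : suc l ℕ.< h) {tw tz tu ty : Carrier} {w z u y : ℕ → Carrier}
    (w-perron : IsPerronVector a l (suc h) tw w)
    (z-perron : IsPerronVector a (suc l) h tz z)
    (u-perron : IsPerronVector a l h tu u)
    (y-perron : IsPerronVector a (suc l) (suc h) ty y) where

    private
      module W = IsPerronVector w-perron
      module Z = IsPerronVector z-perron
      module U = IsPerronVector u-perron
      module Y = IsPerronVector y-perron
      N = neighbourSum a
      T = tw * tz
      S = tu * ty

      l<h : l ℕ.< h
      l<h = ℕₚ.<-trans (ℕₚ.n<1+n l) nonempty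

      0≤S : 0# ≤ S
      0≤S = *-nonNeg (eigenvalue-nonNeg 0<a l<h u-perron) (eigenvalue-nonNeg 0<a (s≤s l<h) y-perron)

      0≤tz = eigenvalue-nonNeg 0<a nonempty z-perron
      0≤tw = eigenvalue-nonNeg 0<a (ℕₚ.m<n⇒m<1+n l<h) w-perron

      -- The three families of inequalities form one index type, so that a single constant κ and a
      -- single use of `contraction` treat them together.
      data Index : Set where
        straight crossed both : ∀ {i j} → i ⊴ j → Index

      lhs rhs : Index → Carrier
      lhs (straight {i} {j} _) = w i * z j
      lhs (crossed {i} {j} _)  = z i * w j
      lhs (both {i} {j} _)     = w i * z j + z i * w j
      rhs (straight {i} {j} _) = u i * y j
      rhs (crossed {i} {j} _)  = u i * y j
      rhs (both {i} {j} _)     = u i * y j + y i * u j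

      0≤uy : ∀ {i j} → 0# ≤ u i * y j
      0≤uy = *-nonNeg (U.nonNeg _) (Y.nonNeg _)

      0≤yu : ∀ {i j} → 0# ≤ y i * u j
      0≤yu = *-nonNeg (Y.nonNeg _) (U.nonNeg _)

      rhs-nonNeg : ∀ i → 0# ≤ rhs i
      rhs-nonNeg (straight p) = 0≤uy
      rhs-nonNeg (crossed p)  = 0≤uy
      rhs-nonNeg (both p)     = +-nonNeg 0≤uy 0≤yu

      zeroʳ′ : ∀ {x y} → y ≈ 0# → x * y ≈ 0#
      zeroʳ′ {x} y≈0 = trans (*-congˡ y≈0) (zeroʳ x)

      zeroˡ′ : ∀ {x y} → x ≈ 0# → x * y ≈ 0#
      zeroˡ′ {y = y} x≈0 = trans (*-congʳ x≈0) (zeroˡ y)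

      lhs-low : ∀ {i j} → i ℕ.≤ l → w i * z j ≈ 0# × z i * w j ≈ 0#
      lhs-low i≤l = zeroˡ′ (W.below i≤l) , zeroˡ′ (Z.below (ℕₚ.m≤n⇒m≤1+n i≤l))

      lhs-high : ∀ {i j} → suc h ℕ.< j → w i * z j ≈ 0# × z i * w j ≈ 0#
      lhs-high h<j = zeroʳ′ (Z.above (ℕₚ.<-trans (ℕₚ.n<1+n h) h<j)) , zeroʳ′ (W.above h<j)

      -- Comparisons of single vectors multiply to comparisons of products. The final constant is
      -- half of the smaller product of constants, because in the family `both` two products share
      -- the bound `u i * y j`.
      combine : Scalable (λ _ → ⊤) w u (suc h) → Scalable (λ _ → ⊤) z y (suc h) →
                Scalable (λ _ → ⊤) z u (suc h) → Scalable (suc l ℕ.<_) w y (2 ℕ.+ h) →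
                ∃[ κ ] 0# < κ × (∀ i → κ * lhs i ≤ rhs i)
      combine (κ₁ , 0<κ₁ , w≤u) (κ₂ , 0<κ₂ , z≤y) (κ₃ , 0<κ₃ , z≤u) (κ₄ , 0<κ₄ , w≤y)
        with common-half (*-pos 0<κ₁ 0<κ₂) (*-pos 0<κ₃ 0<κ₄)
      ... | κ , 0<κ , κ+κ≤κ₁κ₂ , κ+κ≤κ₃κ₄ = κ , 0<κ , bound
        where
        0≤κ = proj₁ 0<κ

        -- A nonzero `z j` forces `i ≤ j ≤ h`. This keeps `i` away from vertex `h + 1`, where `w` is
        -- positive but `u` vanishes.
        straight₂ : ∀ {i j} → i ⊴ j → (κ + κ) * (w i * z j) ≤ u i * y j
        straight₂ {i} {j} p with j ℕₚ.≤? h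
        ... | no j≰h = begin
          (κ + κ) * (w i * z j) ≈⟨ zeroʳ′ (zeroʳ′ (Z.above (ℕₚ.≰⇒> j≰h))) ⟩
          0#                    ≤⟨ 0≤uy ⟩
          u i * y j             ∎
        ... | yes j≤h = begin
          (κ + κ) * (w i * z j)    ≤⟨ *-monoʳ-≤ (*-nonNeg (W.nonNeg i) (Z.nonNeg j)) κ+κ≤κ₁κ₂ ⟩
          κ₁ * κ₂ * (w i * z j)    ≈⟨ solve 4 (λ κ λ′ w z → κ :* λ′ :* (w :* z) := κ :* w :* (λ′ :* z)) refl κ₁ κ₂ (w i) (z j) ⟩
          κ₁ * w i * (κ₂ * z j)    ≤⟨ *-mono-≤ (*-nonNeg (proj₁ 0<κ₁) (W.nonNeg i)) (Y.nonNeg j)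
                                        (w≤u i (s≤s (ℕₚ.≤-trans (⊴⇒≤ p) j≤h)) _) (z≤y j (s≤s j≤h) _) ⟩
          u i * y j                ∎

        -- A nonzero `z i` puts `i`, and therefore `j`, beyond vertex `l + 1`, where `w` is positive
        -- but `y` vanishes.
        crossed₂ : ∀ {i j} → i ⊴ j → (κ + κ) * (z i * w j) ≤ u i * y j
        crossed₂ {i} {j} p with i ℕₚ.≤? h | suc l ℕₚ.<? j | j ℕₚ.≤? suc h
        ... | no i≰h | _ | _ = begin
          (κ + κ) * (z i * w j) ≈⟨ zeroʳ′ (zeroˡ′ (Z.above (ℕₚ.≰⇒> i≰h))) ⟩
          0#                    ≤⟨ 0≤uy ⟩
          u i * y j             ∎
        ... | yes _ | no l≮j | _ = begin
          (κ + κ) * (z i * w j) ≈⟨ zeroʳ′ (zeroˡ′ (Z.below (ℕₚ.≤-trans (⊴⇒≤ p) (ℕₚ.≮⇒≥ l≮j)))) ⟩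
          0#                    ≤⟨ 0≤uy ⟩
          u i * y j             ∎
        ... | yes _ | yes _ | no j≰h = begin
          (κ + κ) * (z i * w j) ≈⟨ zeroʳ′ (zeroʳ′ (W.above (ℕₚ.≰⇒> j≰h))) ⟩
          0#                    ≤⟨ 0≤uy ⟩
          u i * y j             ∎
        ... | yes i≤h | yes l<j | yes j≤h = begin
          (κ + κ) * (z i * w j)    ≤⟨ *-monoʳ-≤ (*-nonNeg (Z.nonNeg i) (W.nonNeg j)) κ+κ≤κ₃κ₄ ⟩
          κ₃ * κ₄ * (z i * w j)    ≈⟨ solve 4 (λ κ λ′ w z → κ :* λ′ :* (w :* z) := κ :* w :* (λ′ :* z)) refl κ₃ κ₄ (z i) (w j) ⟩
          κ₃ * z i * (κ₄ * w j)    ≤⟨ *-mono-≤ (*-nonNeg (proj₁ 0<κ₃) (Z.nonNeg i)) (Y.nonNeg j)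
                                        (z≤u i (s≤s i≤h) _) (w≤y j (s≤s j≤h) l<j) ⟩
          u i * y j                ∎

        halve : ∀ {x y} → 0# ≤ x → (κ + κ) * x ≤ y → κ * x ≤ y
        halve {x} {y} 0≤x 2κx≤y = begin
          κ * x          ≈⟨ +-identityʳ _ ⟨
          κ * x + 0#     ≤⟨ +-mono-≤ ≤-refl (*-nonNeg 0≤κ 0≤x) ⟩
          κ * x + κ * x  ≈⟨ distribʳ x κ κ ⟨
          (κ + κ) * x    ≤⟨ 2κx≤y ⟩
          y              ∎

        average : ∀ {x x′ y} → (κ + κ) * x ≤ y → (κ + κ) * x′ ≤ y → κ * (x + x′) ≤ y
        average {x} {x′} {y} 2κx≤y 2κx′≤y = *-cancelˡ-≤ 0<2 (begin
          (1# + 1#) * (κ * (x + x′))     ≈⟨ solve 3 (λ κ x y → (con (+ 1) :+ con (+ 1)) :* (κ :* (x :+ y)) := (κ :+ κ) :* x :+ (κ :+ κ) :* y) refl κ x x′ ⟩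
          (κ + κ) * x + (κ + κ) * x′     ≤⟨ +-mono-≤ 2κx≤y 2κx′≤y ⟩
          y + y                          ≈⟨ solve 1 (λ y → y :+ y := (con (+ 1) :+ con (+ 1)) :* y) refl y ⟩
          (1# + 1#) * y                  ∎)

        bound : ∀ i → κ * lhs i ≤ rhs i
        bound (straight p) = halve (*-nonNeg (W.nonNeg _) (Z.nonNeg _)) (straight₂ p)
        bound (crossed p)  = halve (*-nonNeg (Z.nonNeg _) (W.nonNeg _)) (crossed₂ p)
        bound (both {i} {j} p) = begin
          κ * (w i * z j + z i * w j) ≤⟨ average (straight₂ p) (crossed₂ p) ⟩
          u i * y j                   ≈⟨ +-identityʳ _ ⟨
          u i * y j + 0#              ≤⟨ +-mono-≤ ≤-refl 0≤yu ⟩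
          u i * y j + y i * u j       ∎

      base : ∃[ κ ] 0# < κ × (∀ i → κ * lhs i ≤ rhs i)
      base = combine
        (scalable W.nonNeg U.nonNeg λ k<h _ 0<w → U.positive (proj₁ (W.supported 0<w)) (s≤s⁻¹ k<h))
        (scalable Z.nonNeg Y.nonNeg λ k<h _ 0<z → Y.positive (proj₁ (Z.supported 0<z)) (ℕₚ.<⇒≤ k<h))
        (scalable Z.nonNeg U.nonNeg λ k<h _ 0<z → U.positive (ℕₚ.<-trans (ℕₚ.n<1+n l) (proj₁ (Z.supported 0<z))) (s≤s⁻¹ k<h))
        (scalable W.nonNeg Y.nonNeg λ k<h l<k _ → Y.positive l<k (s≤s⁻¹ k<h))

      infix 8 _⊗_
      _⊗_ : (f g : ℕ → Carrier) → ℕ → ℕ → Carrier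
      (f ⊗ g) i j = f i * g j

      -- One simultaneous step of two walks: the tensor square of the adjacency operator, applied to
      -- a function of pairs and evaluated at (i + 1, j + 1).
      spread : (ℕ → ℕ → Carrier) → ℕ → ℕ → Carrier
      spread B i j = a i * a j * B i j + (a i * a (suc j) * B i (2 ℕ.+ j) +
        (a (suc i) * a j * B (2 ℕ.+ i) j + a (suc i) * a (suc j) * B (2 ℕ.+ i) (2 ℕ.+ j)))

      spread-* : ∀ f g i j → N f i * N g j ≈ spread (f ⊗ g) i j
      spread-* f g i j = solve 8 (λ a a′ b b′ x x′ y y′ →
        (a :* x :+ a′ :* x′) :* (b :* y :+ b′ :* y′) :=
        a :* b :* (x :* y) :+ (a :* b′ :* (x :* y′) :+ (a′ :* b :* (x′ :* y) :+ a′ :* b′ :* (x′ :* y′))))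
        refl (a i) (a (suc i)) (a j) (a (suc j)) (f i) (f (2 ℕ.+ i)) (g j) (g (2 ℕ.+ j))

      spread-+ : ∀ B C i j → spread (λ i j → B i j + C i j) i j ≈ spread B i j + spread C i j
      spread-+ B C i j = solve 12 (λ a b c d p p′ q q′ r r′ s s′ →
        a :* (p :+ p′) :+ (b :* (q :+ q′) :+ (c :* (r :+ r′) :+ d :* (s :+ s′))) :=
        a :* p :+ (b :* q :+ (c :* r :+ d :* s)) :+ (a :* p′ :+ (b :* q′ :+ (c :* r′ :+ d :* s′))))
        refl (a i * a j) (a i * a (suc j)) (a (suc i) * a j) (a (suc i) * a (suc j))
        (B i j) (C i j) (B i (2 ℕ.+ j)) (C i (2 ℕ.+ j)) (B (2 ℕ.+ i) j) (C (2 ℕ.+ i) j)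
        (B (2 ℕ.+ i) (2 ℕ.+ j)) (C (2 ℕ.+ i) (2 ℕ.+ j))

      interchange : ∀ p q x y → p * q * (x * y) ≈ p * x * (q * y)
      interchange = solve 4 (λ p q x y → p :* q :* (x :* y) := p :* x :* (q :* y)) refl

      straight-below : ∀ i j → T * (w (suc i) * z (suc j)) ≤ spread (w ⊗ z) i j
      straight-below i j = begin
        T * (w (suc i) * z (suc j))           ≈⟨ interchange tw tz _ _ ⟩
        tw * w (suc i) * (tz * z (suc j))     ≤⟨ *-mono-≤ (*-nonNeg 0≤tw (W.nonNeg (suc i))) (neighbourSum-nonNeg 0<a Z.nonNeg j)
                                                   (subsolution 0<a w-perron i) (subsolution 0<a z-perron j) ⟩
        N w i * N z j                         ≈⟨ spread-* w z i j ⟩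
        spread (w ⊗ z) i j               ∎

      crossed-below : ∀ i j → T * (z (suc i) * w (suc j)) ≤ spread (z ⊗ w) i j
      crossed-below i j = begin
        T * (z (suc i) * w (suc j))           ≈⟨ *-congʳ (*-comm tw tz) ⟩
        tz * tw * (z (suc i) * w (suc j))     ≈⟨ interchange tz tw _ _ ⟩
        tz * z (suc i) * (tw * w (suc j))     ≤⟨ *-mono-≤ (*-nonNeg 0≤tz (Z.nonNeg (suc i))) (neighbourSum-nonNeg 0<a W.nonNeg j)
                                                   (subsolution 0<a z-perron i) (subsolution 0<a w-perron j) ⟩
        N z i * N w j                         ≈⟨ spread-* z w i j ⟩
        spread (z ⊗ w) i j                ∎

      -- The right-hand side needs the eigenvalue equations themselves, since `subsolution`
      -- estimates in the wrong direction; hence both positions must lie in their segments.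
      straight-exact : ∀ {i j} → l ℕ.< suc i → suc i ℕ.≤ h → suc l ℕ.< suc j → suc j ℕ.≤ suc h →
        spread (u ⊗ y) i j ≈ S * (u (suc i) * y (suc j))
      straight-exact {i} {j} l<i i≤h l<j j≤h = begin-equality
        spread (u ⊗ y) i j       ≈⟨ spread-* u y i j ⟨
        N u i * N y j                        ≈⟨ *-cong (U.eigen l<i i≤h) (Y.eigen l<j j≤h) ⟩
        tu * u (suc i) * (ty * y (suc j))    ≈⟨ interchange tu ty _ _ ⟨
        S * (u (suc i) * y (suc j))          ∎

      crossed-exact : ∀ {i j} → suc l ℕ.< suc i → suc i ℕ.≤ suc h → l ℕ.< suc j → suc j ℕ.≤ h →
        spread (y ⊗ u) i j ≈ S * (y (suc i) * u (suc j))
      crossed-exact {i} {j} l<i i≤h l<j j≤h = begin-equality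
        spread (y ⊗ u) i j       ≈⟨ spread-* y u i j ⟨
        N y i * N u j                        ≈⟨ *-cong (Y.eigen l<i i≤h) (U.eigen l<j j≤h) ⟩
        ty * y (suc i) * (tu * u (suc j))    ≈⟨ interchange ty tu _ _ ⟨
        ty * tu * (y (suc i) * u (suc j))    ≈⟨ *-congʳ (*-comm ty tu) ⟩
        S * (y (suc i) * u (suc j))          ∎

      module _ {κ} (0≤κ : 0# ≤ κ) (κlhs≤rhs : ∀ i → κ * lhs i ≤ rhs i) where

        infixr 5 _⊕_
        _⊕_ : ∀ {x y x′ y′} → κ * x ≤ y → κ * x′ ≤ y′ → κ * (x + x′) ≤ y + y′
        _⊕_ {x} {x′ = x′} p q = Order.≤-respˡ-≈ (sym (distribˡ κ x x′)) (+-mono-≤ p q)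

        weighted : ∀ {c x y} → 0# ≤ c → κ * x ≤ y → κ * (c * x) ≤ c * y
        weighted {c} {x} {y} 0≤c κx≤y = begin
          κ * (c * x)  ≈⟨ solve 3 (λ κ c x → κ :* (c :* x) := c :* (κ :* x)) refl κ c x ⟩
          c * (κ * x)  ≤⟨ *-monoˡ-≤ 0≤c κx≤y ⟩
          c * y        ∎

        0≤aa : ∀ i j → 0# ≤ a i * a j
        0≤aa i j = *-nonNeg (proj₁ (0<a i)) (proj₁ (0<a j))

        spread-mono : ∀ {B B′ i j} → κ * B i j ≤ B′ i j → κ * B i (2 ℕ.+ j) ≤ B′ i (2 ℕ.+ j) →
          κ * B (2 ℕ.+ i) j ≤ B′ (2 ℕ.+ i) j → κ * B (2 ℕ.+ i) (2 ℕ.+ j) ≤ B′ (2 ℕ.+ i) (2 ℕ.+ j) →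
          κ * spread B i j ≤ spread B′ i j
        spread-mono {i = i} {j} b₀₀ b₀₂ b₂₀ b₂₂ =
          weighted (0≤aa i j) b₀₀ ⊕ weighted (0≤aa i (suc j)) b₀₂ ⊕
          weighted (0≤aa (suc i) j) b₂₀ ⊕ weighted (0≤aa (suc i) (suc j)) b₂₂

        -- From the diagonal the walks can reach the pair (i + 2, i), which is out of order and has
        -- no inequality of its own. It carries the same weight as (i, i + 2), so a bound for the
        -- sum of the two suffices.
        spread-mono-diag : ∀ {B B′ i} → κ * B i i ≤ B′ i i →
          κ * (B i (2 ℕ.+ i) + B (2 ℕ.+ i) i) ≤ B′ i (2 ℕ.+ i) + B′ (2 ℕ.+ i) i →
          κ * B (2 ℕ.+ i) (2 ℕ.+ i) ≤ B′ (2 ℕ.+ i) (2 ℕ.+ i) →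
          κ * spread B i i ≤ spread B′ i i
        spread-mono-diag {B} {B′} {i} b₀₀ b₀₂₊₂₀ b₂₂ = begin
          κ * spread B i i ≈⟨ *-congˡ (regroup B) ⟩
          κ * grouped B    ≤⟨ weighted (0≤aa i i) b₀₀ ⊕ weighted (0≤aa i (suc i)) b₀₂₊₂₀ ⊕ weighted (0≤aa (suc i) (suc i)) b₂₂ ⟩
          grouped B′       ≈⟨ regroup B′ ⟨
          spread B′ i i    ∎
          where
          grouped : (ℕ → ℕ → Carrier) → Carrier
          grouped C = a i * a i * C i i + (a i * a (suc i) * (C i (2 ℕ.+ i) + C (2 ℕ.+ i) i) +
                      a (suc i) * a (suc i) * C (2 ℕ.+ i) (2 ℕ.+ i))

          regroup : ∀ C → spread C i i ≈ grouped C
          regroup C = solve 6 (λ a b p q r s →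
            a :* a :* p :+ (a :* b :* q :+ (b :* a :* r :+ b :* b :* s)) :=
            a :* a :* p :+ (a :* b :* (q :+ r) :+ b :* b :* s))
            refl (a i) (a (suc i)) (C i i) (C i (2 ℕ.+ i)) (C (2 ℕ.+ i) i) (C (2 ℕ.+ i) (2 ℕ.+ i))

        vanishing : ∀ {x y} → x ≈ 0# → 0# ≤ y → κ * (T * x) ≤ S * y
        vanishing {x} {y} x≈0 0≤y = begin
          κ * (T * x) ≈⟨ zeroʳ′ (zeroʳ′ x≈0) ⟩
          0#          ≤⟨ *-nonNeg 0≤S 0≤y ⟩
          S * y       ∎

        transport : ∀ {x y b b′} → T * x ≤ b → κ * b ≤ b′ → b′ ≈ S * y → κ * (T * x) ≤ S * y
        transport {x} {y} {b} {b′} Tx≤b κb≤b′ b′≈Sy = begin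
          κ * (T * x) ≤⟨ *-monoˡ-≤ 0≤κ Tx≤b ⟩
          κ * b       ≤⟨ κb≤b′ ⟩
          b′          ≈⟨ b′≈Sy ⟩
          S * y       ∎

        -- Since `i + 2 ≤ j`, all four neighbours of the pair (i + 1, j + 1) are again ordered, and
        -- the family under consideration bounds each of them separately.
        module Inside {i j} (l<1+i : l ℕ.< suc i) (i<j : i ℕ.< j) (j≤h : j ℕ.≤ h) (p : suc i ⊴ suc j) (q : 2 ℕ.+ i ⊴ j) where

          i<h = ℕₚ.≤-trans i<j j≤h
          l<j = ℕₚ.≤-trans l<1+i i<j

          far : ∀ {B B′} (index : ∀ {i j} → i ⊴ j → Index) →
            (∀ {i j} (p : i ⊴ j) → κ * B i j ≤ B′ i j) → κ * spread B i j ≤ spread B′ i j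
          far {B} {B′} index bound = spread-mono {B} {B′} (bound (⊴-pred p)) (bound (widen (⊴-pred p))) (bound q) (bound (⊴-suc p))

          straight-step : κ * (T * (w (suc i) * z (suc j))) ≤ S * (u (suc i) * y (suc j))
          straight-step = transport (straight-below i j) (far straight (λ p → κlhs≤rhs (straight p)))
            (straight-exact l<1+i i<h (s≤s l<j) (s≤s j≤h))

          crossed-step : κ * (T * (z (suc i) * w (suc j))) ≤ S * (u (suc i) * y (suc j))
          crossed-step = transport (crossed-below i j) (far crossed (λ p → κlhs≤rhs (crossed p)))
            (straight-exact l<1+i i<h (s≤s l<j) (s≤s j≤h))

          both-step : κ * (T * (w (suc i) * z (suc j) + z (suc i) * w (suc j))) ≤
                      S * (u (suc i) * y (suc j) + y (suc i) * u (suc j))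
          both-step with suc l ℕₚ.<? suc i | suc j ℕₚ.≤? h
          ... | no l≮i | _ = begin
            κ * (T * (w (suc i) * z (suc j) + z (suc i) * w (suc j)))
              ≈⟨ *-congˡ (*-congˡ (trans (+-congˡ (zeroˡ′ (Z.below (ℕₚ.≮⇒≥ l≮i)))) (+-identityʳ _))) ⟩
            κ * (T * (w (suc i) * z (suc j)))
              ≤⟨ straight-step ⟩
            S * (u (suc i) * y (suc j))
              ≤⟨ *-monoˡ-≤ 0≤S (Order.≤-respˡ-≈ (+-identityʳ _) (+-mono-≤ ≤-refl 0≤yu)) ⟩
            S * (u (suc i) * y (suc j) + y (suc i) * u (suc j)) ∎
          ... | yes _ | no j≮h = begin
            κ * (T * (w (suc i) * z (suc j) + z (suc i) * w (suc j)))
              ≈⟨ *-congˡ (*-congˡ (trans (+-congʳ (zeroʳ′ (Z.above (ℕₚ.≰⇒> j≮h)))) (+-identityˡ _))) ⟩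
            κ * (T * (z (suc i) * w (suc j)))
              ≤⟨ crossed-step ⟩
            S * (u (suc i) * y (suc j))
              ≤⟨ *-monoˡ-≤ 0≤S (Order.≤-respˡ-≈ (+-identityʳ _) (+-mono-≤ ≤-refl 0≤yu)) ⟩
            S * (u (suc i) * y (suc j) + y (suc i) * u (suc j)) ∎
          ... | yes 1+l<1+i | yes 1+j≤h = transport
            (Order.≤-respˡ-≈ (sym (distribˡ T _ _)) (Order.≤-respʳ-≈ (sym (spread-+ (w ⊗ z) (z ⊗ w) i j))
              (+-mono-≤ (straight-below i j) (crossed-below i j))))
            (far both (λ p → κlhs≤rhs (both p)))
            (trans (spread-+ (u ⊗ y) (y ⊗ u) i j) (trans
              (+-cong (straight-exact l<1+i i<h (s≤s l<j) (s≤s j≤h))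
                      (crossed-exact 1+l<1+i (ℕₚ.m≤n⇒m≤1+n i<h) (ℕₚ.m<n⇒m<1+n l<j) 1+j≤h))
              (sym (distribˡ S _ _))))

        diag-step : ∀ {i} → suc l ℕ.< suc i → suc i ℕ.≤ h →
          κ * (T * (w (suc i) * z (suc i))) ≤ S * (u (suc i) * y (suc i))
        diag-step {i} l<i i<h = transport (straight-below i i)
          (spread-mono-diag {w ⊗ z} {u ⊗ y} (κlhs≤rhs (straight diag)) (begin
            -- The straight product at (i + 2, i) is the crossed product at the ordered pair (i, i +
            -- 2), so the family `both` applies.
            κ * (w i * z (2 ℕ.+ i) + w (2 ℕ.+ i) * z i) ≈⟨ *-congˡ (+-congˡ (*-comm _ _)) ⟩
            κ * (w i * z (2 ℕ.+ i) + z i * w (2 ℕ.+ i)) ≤⟨ κlhs≤rhs (both (widen diag)) ⟩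
            u i * y (2 ℕ.+ i) + y i * u (2 ℕ.+ i)       ≈⟨ +-congˡ (*-comm _ _) ⟩
            u i * y (2 ℕ.+ i) + u (2 ℕ.+ i) * y i       ∎)
            (κlhs≤rhs (straight diag)))
          (straight-exact (ℕₚ.<-trans (ℕₚ.n<1+n l) l<i) i<h l<i (ℕₚ.m≤n⇒m≤1+n i<h))

        data Position : ∀ {i j} → i ⊴ j → Set ℓ where
          trivial : ∀ {i j} {p : i ⊴ j} → w i * z j ≈ 0# → z i * w j ≈ 0# → Position p
          inside  : ∀ {i j} {p : suc i ⊴ suc j} → l ℕ.< suc i → i ℕ.< j → j ℕ.≤ h → 2 ℕ.+ i ⊴ j → Position p
          on-diag : ∀ {i} → suc l ℕ.< suc i → suc i ℕ.≤ h → Position (diag {suc i})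

        position : ∀ {i j} (p : i ⊴ j) → Position p
        position {zero} {j} p = let (s , c) = lhs-low {0} {j} z≤n in trivial s c
        position {suc i} diag with suc l ℕₚ.<? suc i | suc i ℕₚ.≤? h
        ... | yes l<i | yes i≤h = on-diag l<i i≤h
        ... | no l≮i  | _       = trivial (zeroʳ′ (Z.below (ℕₚ.≮⇒≥ l≮i))) (zeroˡ′ (Z.below (ℕₚ.≮⇒≥ l≮i)))
        ... | yes _   | no i≰h  = trivial (zeroʳ′ (Z.above (ℕₚ.≰⇒> i≰h))) (zeroˡ′ (Z.above (ℕₚ.≰⇒> i≰h)))
        position {suc i} (widen {j = j} p) with l ℕₚ.<? suc i | suc j ℕₚ.≤? h
        ... | yes l<i | yes j≤h = inside l<i (s≤s (ℕₚ.≤-trans (ℕₚ.n≤1+n i) (⊴⇒≤ p))) j≤h (⊴-suc p)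
        ... | no l≮i  | _       = let (s , c) = lhs-low {suc i} {2 ℕ.+ j} (ℕₚ.≮⇒≥ l≮i) in trivial s c
        ... | yes _   | no j≰h  = let (s , c) = lhs-high {suc i} {2 ℕ.+ j} (s≤s (ℕₚ.≰⇒> j≰h)) in trivial s c

        step : ∀ i → κ * (T * lhs i) ≤ S * rhs i
        step (straight p) with position p
        ... | trivial s c         = vanishing s 0≤uy
        ... | inside l<i i<j j≤h q = Inside.straight-step l<i i<j j≤h p q
        ... | on-diag l<i i≤h     = diag-step l<i i≤h
        step (crossed p) with position p
        ... | trivial s c         = vanishing c 0≤uy
        ... | inside l<i i<j j≤h q = Inside.crossed-step l<i i<j j≤h p q
        ... | on-diag l<i i≤h     = Order.≤-respˡ-≈ (*-congˡ (*-congˡ (*-comm _ _))) (diag-step l<i i≤h)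
        step (both p) with position p
        ... | trivial s c         = vanishing (trans (+-cong s c) (+-identityˡ 0#)) (rhs-nonNeg (both p))
        ... | inside l<i i<j j≤h q = Inside.both-step l<i i<j j≤h p q
        ... | on-diag {i} l<i i≤h = begin
          κ * (T * (w (suc i) * z (suc i) + z (suc i) * w (suc i)))
            ≈⟨ solve 4 (λ κ t w z → κ :* (t :* (w :* z :+ z :* w)) := κ :* (t :* (w :* z)) :+ κ :* (t :* (w :* z))) refl κ T (w (suc i)) (z (suc i)) ⟩
          κ * (T * (w (suc i) * z (suc i))) + κ * (T * (w (suc i) * z (suc i)))
            ≤⟨ +-mono-≤ (diag-step l<i i≤h) (diag-step l<i i≤h) ⟩
          S * (u (suc i) * y (suc i)) + S * (u (suc i) * y (suc i))
            ≈⟨ solve 3 (λ s u y → s :* (u :* y) :+ s :* (u :* y) := s :* (u :* y :+ y :* u)) refl S (u (suc i)) (y (suc i)) ⟩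
          S * (u (suc i) * y (suc i) + y (suc i) * u (suc i)) ∎

    comparison : tw * tz ≤ tu * ty
    comparison = contraction lhs rhs 0≤S base (λ κ 0<κ → step (proj₁ 0<κ)) λ lhs≤0 →
      -- Vertex `l + 2` lies in all four segments by `nonempty`, so the left-hand side is positive
      -- at the diagonal pair there.
      <⇒≱ (*-pos (W.positive (ℕₚ.<-trans (ℕₚ.n<1+n l) (ℕₚ.n<1+n (suc l))) (ℕₚ.m≤n⇒m≤1+n nonempty))
                 (Z.positive (ℕₚ.n<1+n (suc l)) nonempty))
          (lhs≤0 (straight (diag {2 ℕ.+ l})))

-- Boundedness and positivity near a point.

module Existence {ℓ} (ℝ : CompleteOrderedField ℓ) where
  open OrderedField ℝ
  open Path ℝ
  open ≤-Reasoning

  infix 4 _within_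
  _within_ : Carrier → Carrier → Set ℓ
  x within q = - q ≤ x × x ≤ q

  within⇒nonNeg : ∀ {x q} → x within q → 0# ≤ q
  within⇒nonNeg {x} {q} (-q≤x , x≤q) with ≤-<-connex 0# q
  ... | inj₁ 0≤q = 0≤q
  ... | inj₂ q<0 = contradiction (begin
    0#   ≤⟨ x≤y⇒0≤y-x (proj₁ q<0) ⟩
    0# - q ≈⟨ +-identityˡ _ ⟩
    - q  ≤⟨ -q≤x ⟩
    x    ≤⟨ x≤q ⟩
    q    ∎) (<⇒≱ q<0)

  within-+ : ∀ {x y p q} → x within p → y within q → x + y within p + q
  within-+ {p = p} {q} (-p≤x , x≤p) (-q≤y , y≤q) =
    Order.≤-respˡ-≈ (solve 2 (λ p q → :- p :+ :- q := :- (p :+ q)) refl p q) (+-mono-≤ -p≤x -q≤y) ,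
    +-mono-≤ x≤p y≤q

  within-neg : ∀ {x q} → x within q → - x within q
  within-neg {q = q} (-q≤x , x≤q) = x≤y⇒-y≤-x x≤q ,
    Order.≤-respʳ-≈ (-‿involutive q) (x≤y⇒-y≤-x -q≤x)

  within-abs : ∀ x → ∃[ q ] x within q
  within-abs x with Order.total 0# x
  ... | inj₁ 0≤x = x , (begin
    - x  ≤⟨ x≤y⇒-y≤-x 0≤x ⟩
    - 0# ≈⟨ -0#≈0# ⟩
    0#   ≤⟨ 0≤x ⟩
    x    ∎) , ≤-refl
  ... | inj₂ x≤0 = - x , Order.reflexive (-‿involutive x) , (begin
    x    ≤⟨ x≤0 ⟩
    0#   ≈⟨ -0#≈0# ⟨
    - 0# ≤⟨ x≤y⇒-y≤-x x≤0 ⟩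
    - x  ∎)

  -- Each bound comes from a sum of two products of non-negative factors; for the upper one, (p -
  -- x)(q + y) + (p + x)(q - y) = 2 (p q - x y).
  within-* : ∀ {x y p q} → x within p → y within q → x * y within p * q
  within-* {x} {y} {p} {q} x-within@(-p≤x , x≤p) y-within@(-q≤y , y≤q) = lower , upper
    where
    upper : x * y ≤ p * q
    upper = *-cancelˡ-≤ 0<2 (0≤y-x⇒x≤y (Order.≤-respʳ-≈
      (solve 4 (λ x y p q → (p :- x) :* (y :- :- q) :+ (x :- :- p) :* (q :- y) :=
         (con (+ 1) :+ con (+ 1)) :* (p :* q) :- (con (+ 1) :+ con (+ 1)) :* (x :* y)) refl x y p q)
      (+-nonNeg (*-nonNeg (x≤y⇒0≤y-x x≤p) (x≤y⇒0≤y-x -q≤y)) (*-nonNeg (x≤y⇒0≤y-x -p≤x) (x≤y⇒0≤y-x y≤q)))))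

    lower : - (p * q) ≤ x * y
    lower = *-cancelˡ-≤ 0<2 (0≤y-x⇒x≤y (Order.≤-respʳ-≈
      (solve 4 (λ x y p q → (p :- x) :* (q :- y) :+ (x :- :- p) :* (y :- :- q) :=
         (con (+ 1) :+ con (+ 1)) :* (x :* y) :- (con (+ 1) :+ con (+ 1)) :* (:- (p :* q))) refl x y p q)
      (+-nonNeg (*-nonNeg (x≤y⇒0≤y-x x≤p) (x≤y⇒0≤y-x y≤q)) (*-nonNeg (x≤y⇒0≤y-x -p≤x) (x≤y⇒0≤y-x -q≤y)))))

  Bounded : (Carrier → Carrier) → Set ℓ
  Bounded e = ∃[ q ] (∀ d → d within 1# → e d within q)

  bounded-const : ∀ x → Bounded (λ _ → x)
  bounded-const x = let (q , x-within) = within-abs x in q , λ _ _ → x-within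

  bounded-id : Bounded (λ d → d)
  bounded-id = 1# , λ _ d-within → d-within

  bounded-+ : ∀ {e f} → Bounded e → Bounded f → Bounded (λ d → e d + f d)
  bounded-+ (p , e-within) (q , f-within) = p + q , λ d w → within-+ (e-within d w) (f-within d w)

  bounded-* : ∀ {e f} → Bounded e → Bounded f → Bounded (λ d → e d * f d)
  bounded-* (p , e-within) (q , f-within) = p * q , λ d w → within-* (e-within d w) (f-within d w)

  bounded-neg : ∀ {e} → Bounded e → Bounded (λ d → - e d)
  bounded-neg (q , e-within) = q , λ d w → within-neg (e-within d w)

  within-weaken : ∀ {x p q} → p ≤ q → x within p → x within q
  within-weaken p≤q (-p≤x , x≤p) = Order.trans (x≤y⇒-y≤-x p≤q) -p≤x , Order.trans x≤p p≤q

  -- A quantitative form of continuity: if q bounds e on |d| ≤ 1, then δ = x / (1 + q + x) satisfies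
  -- δ ≤ 1 and δ q < x.
  positive-near : ∀ {x e} → 0# < x → Bounded e →
    ∃[ δ ] 0# < δ × (∀ d → d within δ → 0# < x + d * e d)
  positive-near {x} {e} 0<x (q , e-within) = near (reciprocal 0<1+q+x)
    where
    0≤1 = proj₁ 0<1
    0≤q : 0# ≤ q
    0≤q = within⇒nonNeg (e-within 0# (Order.trans (x≤y⇒-y≤-x 0≤1) (Order.reflexive -0#≈0#) , 0≤1))

    0<1+q+x : 0# < 1# + (q + x)
    0<1+q+x = +-pos-nonNeg 0<1 (+-nonNeg 0≤q (proj₁ 0<x))

    near : ∃[ r ] 0# < r × (1# + (q + x)) * r ≈ 1# → ∃[ δ ] 0# < δ × (∀ d → d within δ → 0# < x + d * e d)
    near (r , 0<r , [1+q+x]r≈1) = δ , 0<δ , λ d d-within → begin-strict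
      0#                                    <⟨ *-pos 0<δ (+-pos-nonNeg 0<1 (proj₁ 0<x)) ⟩
      δ * (1# + x)                          ≈⟨ solve 3 (λ δ q x → δ :* (con (+ 1) :+ x) := δ :* (con (+ 1) :+ (q :+ x)) :+ :- (δ :* q)) refl δ q x ⟩
      δ * (1# + (q + x)) + - (δ * q)        ≤⟨ +-mono-≤ ≤-refl (proj₁ (within-* d-within (e-within d (within-weaken δ≤1 d-within)))) ⟩
      δ * (1# + (q + x)) + d * e d          ≈⟨ +-congʳ (solve 3 (λ x r s → x :* r :* s := x :* (s :* r)) refl x r (1# + (q + x))) ⟩
      x * ((1# + (q + x)) * r) + d * e d    ≈⟨ +-congʳ (*-congˡ [1+q+x]r≈1) ⟩
      x * 1# + d * e d                      ≈⟨ +-congʳ (*-identityʳ x) ⟩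
      x + d * e d                           ∎
      where
      δ = x * r

      0<δ : 0# < δ
      0<δ = *-pos 0<x 0<r

      δ≤1 : δ ≤ 1#
      δ≤1 = begin
        x * r                  ≈⟨ *-congʳ (+-identityˡ x) ⟨
        (0# + x) * r           ≤⟨ *-monoʳ-≤ (proj₁ 0<r) (+-mono-≤ (+-nonNeg 0≤1 0≤q) ≤-refl) ⟩
        (1# + q + x) * r       ≈⟨ *-congʳ (+-assoc 1# q x) ⟩
        (1# + (q + x)) * r     ≈⟨ [1+q+x]r≈1 ⟩
        1#                     ∎

  -- Orthogonal polynomials of the path and existence of a Perron vector.

  module Recurrence {a : ℕ → Carrier} (0<a : ∀ k → 0# < a k) where

    c : ℕ → Carrier
    c k = proj₁ (reciprocal (0<a (suc k)))

    a*c≈1 : ∀ k → a (suc k) * c k ≈ 1#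
    a*c≈1 k = proj₂ (proj₂ (reciprocal (0<a (suc k))))

    -- The three-term recurrence is the eigenvalue equation at vertex `k + 1` solved for its right
    -- neighbour.
    p : Carrier → ℕ → Carrier
    p t zero          = 0#
    p t (suc zero)    = 1#
    p t (suc (suc k)) = c k * (t * p t (suc k) - a k * p t k)

    p-eigen : ∀ t k → neighbourSum a (p t) k ≈ t * p t (suc k)
    p-eigen t k = trans
      (solve 5 (λ ak a′ c x y → ak :* y :+ a′ :* (c :* (x :- ak :* y)) := a′ :* c :* x :+ (con (+ 1) :- a′ :* c) :* (ak :* y))
        refl (a k) (a (suc k)) (c k) (t * p t (suc k)) (p t k))
      (trans (+-cong (*-congʳ (a*c≈1 k)) (*-congʳ (+-congˡ (-‿cong (a*c≈1 k)))))
        (solve 2 (λ x y → con (+ 1) :* x :+ (con (+ 1) :- con (+ 1)) :* y := x) refl (t * p t (suc k)) (a k * p t k)))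

    p-cong : ∀ {t t′} → t ≈ t′ → ∀ k → p t k ≈ p t′ k
    p-cong t≈t′ zero          = refl
    p-cong t≈t′ (suc zero)    = refl
    p-cong t≈t′ (suc (suc k)) = *-congˡ (+-cong (*-cong t≈t′ (p-cong t≈t′ (suc k))) (-‿cong (*-congˡ (p-cong t≈t′ k))))

    -- The difference quotient of `p` between `s` and `s + d`, given by a recurrence of its own so
    -- that nothing is divided by `d`.
    slope : Carrier → Carrier → ℕ → Carrier
    slope s d zero          = 0#
    slope s d (suc zero)    = 0#
    slope s d (suc (suc k)) = c k * (p s (suc k) + (s + d) * slope s d (suc k) + - (a k * slope s d k))

    p-slope : ∀ s d k → p (s + d) k ≈ p s k + d * slope s d k
    p-slope s d zero       = solve 1 (λ d → con (+ 0) := con (+ 0) :+ d :* con (+ 0)) refl d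
    p-slope s d (suc zero) = solve 1 (λ d → con (+ 1) := con (+ 1) :+ d :* con (+ 0)) refl d
    p-slope s d (suc (suc k)) = trans
      (*-congˡ (+-cong (*-congˡ (p-slope s d (suc k))) (-‿cong (*-congˡ (p-slope s d k)))))
      (solve 8 (λ c s d f g F G a → c :* ((s :+ d) :* (F :+ d :* f) :+ :- (a :* (G :+ d :* g))) :=
          c :* (s :* F :- a :* G) :+ d :* (c :* (F :+ (s :+ d) :* f :+ :- (a :* g))))
        refl (c k) s d (slope s d (suc k)) (slope s d k) (p s (suc k)) (p s k) (a k))

    slope-bounded : ∀ s k → Bounded (λ d → slope s d k)
    slope-bounded s zero          = bounded-const 0#
    slope-bounded s (suc zero)    = bounded-const 0#
    slope-bounded s (suc (suc k)) = bounded-* (bounded-const (c k))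
      (bounded-+ (bounded-+ (bounded-const (p s (suc k)))
        (bounded-* (bounded-+ (bounded-const s) bounded-id) (slope-bounded s (suc k))))
        (bounded-neg (bounded-* (bounded-const (a k)) (slope-bounded s k))))

    -- Summing all `a k + a (suc k)` with `k < n` gives a bound for each of them without taking a
    -- maximum.
    threshold : ℕ → Carrier
    threshold zero    = 0#
    threshold (suc n) = threshold n + (a n + a (suc n))

    a+a-nonNeg : ∀ n → 0# ≤ a n + a (suc n)
    a+a-nonNeg n = +-nonNeg (proj₁ (0<a n)) (proj₁ (0<a (suc n)))

    threshold-nonNeg : ∀ n → 0# ≤ threshold n
    threshold-nonNeg zero    = ≤-refl
    threshold-nonNeg (suc n) = +-nonNeg (threshold-nonNeg n) (a+a-nonNeg n)

    a+a≤threshold : ∀ {k} n → k ℕ.< n → a k + a (suc k) ≤ threshold n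
    a+a≤threshold {k} (suc n) k<1+n with ℕₚ.m<1+n⇒m<n∨m≡n k<1+n
    ... | inj₁ k<n = begin
      a k + a (suc k)                   ≤⟨ a+a≤threshold n k<n ⟩
      threshold n                       ≈⟨ +-identityʳ _ ⟨
      threshold n + 0#                  ≤⟨ +-mono-≤ ≤-refl (a+a-nonNeg n) ⟩
      threshold n + (a n + a (suc n))   ∎
    ... | inj₂ ≡.refl = begin
      a k + a (suc k)                   ≈⟨ +-identityˡ _ ⟨
      0# + (a k + a (suc k))            ≤⟨ +-mono-≤ (threshold-nonNeg n) ≤-refl ⟩
      threshold k + (a k + a (suc k))   ∎

    -- Inductively, `t * p t (suc k)` is at least `a k * p t k + a (suc k) * p t (suc k)`; comparing
    -- with the recurrence leaves the next entry at least as large as `p t (suc k)`.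
    p-increasing : ∀ {t n} → threshold n ≤ t → ∀ k → k ℕ.≤ n → 0# < p t (suc k) × p t k ≤ p t (suc k)
    p-increasing θ≤t zero k≤n = 0<1 , proj₁ 0<1
    p-increasing {t} {n} θ≤t (suc k) k<n with p-increasing θ≤t k (ℕₚ.<⇒≤ k<n)
    ... | 0<p , pₖ≤p = (begin-strict 0# <⟨ 0<p ⟩ p t (suc k) ≤⟨ p≤pₖ₊₂ ⟩ p t (2 ℕ.+ k) ∎) , p≤pₖ₊₂
      where
      p≤pₖ₊₂ : p t (suc k) ≤ p t (2 ℕ.+ k)
      p≤pₖ₊₂ = *-cancelˡ-≤ (0<a (suc k)) (+-cancelˡ-≤ (a k * p t k) (begin
        a k * p t k + a (suc k) * p t (suc k)        ≤⟨ +-mono-≤ (*-monoˡ-≤ (proj₁ (0<a k)) pₖ≤p) ≤-refl ⟩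
        a k * p t (suc k) + a (suc k) * p t (suc k)  ≈⟨ distribʳ _ _ _ ⟨
        (a k + a (suc k)) * p t (suc k)              ≤⟨ *-monoʳ-≤ (proj₁ 0<p) (Order.trans (a+a≤threshold n k<n) θ≤t) ⟩
        t * p t (suc k)                              ≈⟨ p-eigen t k ⟨
        a k * p t k + a (suc k) * p t (2 ℕ.+ k)      ∎))

    module _ (m : ℕ) where

      private
        n = suc m

        -- Entries 0 and 1 of `p` are constant and left out. The supremum will be a zero of entry
        -- `n + 1` at which the entries 1, ..., n are positive.
        Bad : Carrier → Set ℓ
        Bad t = ∃[ k ] k ℕ.< n × p t (2 ℕ.+ k) ≤ 0#

        bad-0 : Bad 0#
        bad-0 = 0 , s≤s z≤n , Order.reflexive
          (solve 2 (λ c a → c :* (con (+ 0) :* con (+ 1) :- a :* con (+ 0)) := con (+ 0)) refl (c 0) (a 0))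

        bad-bounded : IsUpperBound Bad (threshold n)
        bad-bounded t (k , k<n , p≤0) with ≤-<-connex t (threshold n)
        ... | inj₁ t≤θ = t≤θ
        ... | inj₂ θ<t = contradiction p≤0 (<⇒≱ (proj₁ (p-increasing (proj₁ θ<t) (suc k) k<n)))

      module AtSupremum (s : Carrier) (s-upper : IsUpperBound Bad s) (s-least : ∀ u → IsUpperBound Bad u → s ≤ u) where

        private
          x+δ≰x : ∀ {x δ} → 0# < δ → ¬ (x + δ ≤ x)
          x+δ≰x {x} {δ} 0<δ x+δ≤x = <⇒≱ 0<δ (+-cancelˡ-≤ x (Order.≤-respʳ-≈ (sym (+-identityʳ x)) x+δ≤x))

          0<δ⇒δ-within : ∀ {δ} → 0# < δ → δ within δ
          0<δ⇒δ-within {δ} 0<δ = 0≤y-x⇒x≤y (Order.≤-respʳ-≈ (solve 1 (λ δ → δ :+ δ := δ :- :- δ) refl δ)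
            (+-nonNeg (proj₁ 0<δ) (proj₁ 0<δ))) , ≤-refl

        -- An entry negative at `s` would be non-positive at some `s + δ` as well, a point of `Bad`
        -- beyond its supremum.
        p-nonNeg : ∀ {k} → k ℕ.< n → 0# ≤ p s (2 ℕ.+ k)
        p-nonNeg {k} k<n with ≤-<-connex 0# (p s (2 ℕ.+ k))
        ... | inj₁ 0≤p = 0≤p
        ... | inj₂ p<0 = contra (positive-near 0<-p (bounded-neg (slope-bounded s (2 ℕ.+ k))))
          where
          0<-p : 0# < - p s (2 ℕ.+ k)
          0<-p = Order.≤-respʳ-≈ (+-identityˡ _) (x≤y⇒0≤y-x (proj₁ p<0)) ,
            λ 0≈-p → proj₂ p<0 (trans (sym (-‿involutive _)) (trans (-‿cong (sym 0≈-p)) -0#≈0#))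

          contra : ∃[ δ ] 0# < δ × (∀ d → d within δ → 0# < - p s (2 ℕ.+ k) + d * - slope s d (2 ℕ.+ k)) →
                   0# ≤ p s (2 ℕ.+ k)
          contra (δ , 0<δ , near) = contradiction (s-upper (s + δ) (k , k<n , p[s+δ]≤0)) (x+δ≰x 0<δ)
            where
            p[s+δ]≤0 : p (s + δ) (2 ℕ.+ k) ≤ 0#
            p[s+δ]≤0 = 0≤y-x⇒x≤y (begin
              0#                                             ≤⟨ proj₁ (near δ (0<δ⇒δ-within 0<δ)) ⟩
              - p s (2 ℕ.+ k) + δ * - slope s δ (2 ℕ.+ k)    ≈⟨ solve 3 (λ p d e → :- p :+ d :* :- e := con (+ 0) :- (p :+ d :* e)) refl (p s (2 ℕ.+ k)) δ (slope s δ (2 ℕ.+ k)) ⟩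
              0# - (p s (2 ℕ.+ k) + δ * slope s δ (2 ℕ.+ k)) ≈⟨ +-congˡ (-‿cong (p-slope s δ (2 ℕ.+ k))) ⟨
              0# - p (s + δ) (2 ℕ.+ k)                       ∎)

        -- At a zero entry the weighted sum of its two neighbours vanishes, so
        -- they cannot be positive and non-negative.
        p-pos : ∀ k → k ℕ.< n → 0# < p s (suc k)
        p-pos zero _ = 0<1
        p-pos (suc k) k<n = p-nonNeg (ℕₚ.<-trans (ℕₚ.n<1+n k) k<n) , λ 0≈p → <⇒≱ (0<sum) (Order.reflexive (begin-equality
          neighbourSum a (p s) (suc k)   ≈⟨ p-eigen s (suc k) ⟩
          s * p s (2 ℕ.+ k)              ≈⟨ *-congˡ 0≈p ⟨
          s * 0#                         ≈⟨ zeroʳ s ⟩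
          0#                             ∎))
          where
          0<sum : 0# < neighbourSum a (p s) (suc k)
          0<sum = +-pos-nonNeg (*-pos (0<a (suc k)) (p-pos k (ℕₚ.<-trans (ℕₚ.n<1+n k) k<n)))
                               (*-nonNeg (proj₁ (0<a (2 ℕ.+ k))) (p-nonNeg k<n))

        -- Otherwise the entries 2, ..., n + 1 are all positive on some interval of radius δ about
        -- `s`, and `s - δ` is a smaller upper bound of `Bad`.
        p-end : p s (suc n) ≈ 0#
        p-end with p s (suc n) Order.≟ 0#
        ... | yes p≈0 = p≈0
        ... | no p≉0 = contra (common-lower-bound
            (λ k δ → ∀ d → d within δ → 0# < p (s + d) (2 ℕ.+ k))
            (λ _ x≤y near d d-within → near d (within-weaken x≤y d-within)) n nearby)
          where
          all-pos : ∀ k → k ℕ.< n → 0# < p s (2 ℕ.+ k)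
          all-pos k k<n with ℕₚ.m<1+n⇒m<n∨m≡n k<n
          ... | inj₁ k<m    = p-pos (suc k) (s≤s k<m)
          ... | inj₂ ≡.refl = p-nonNeg (ℕₚ.n<1+n m) , p≉0 ∘ sym

          nearby : ∀ k → k ℕ.< n → ∃[ δ ] 0# < δ × (∀ d → d within δ → 0# < p (s + d) (2 ℕ.+ k))
          nearby k k<n = let (δ , 0<δ , near) = positive-near (all-pos k k<n) (slope-bounded s (2 ℕ.+ k)) in
            δ , 0<δ , λ d d-within → <-respʳ-≈ (sym (p-slope s d (2 ℕ.+ k))) (near d d-within)

          contra : ∃[ δ ] 0# < δ × (∀ k → k ℕ.< n → ∀ d → d within δ → 0# < p (s + d) (2 ℕ.+ k)) → p s (suc n) ≈ 0#
          contra (δ , 0<δ , near) = contradiction (begin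
              s + δ      ≤⟨ +-monoˡ-≤ δ (s-least (s - δ) s-δ-upper) ⟩
              s - δ + δ  ≈⟨ solve 2 (λ s δ → s :- δ :+ δ := s) refl s δ ⟩
              s          ∎) (x+δ≰x 0<δ)
            where
            s-δ-upper : IsUpperBound Bad (s - δ)
            s-δ-upper t bad@(k , k<n , p≤0) with ≤-<-connex t (s - δ)
            ... | inj₁ t≤s-δ = t≤s-δ
            ... | inj₂ s-δ<t = contradiction
              (Order.≤-respˡ-≈ (p-cong (solve 2 (λ s t → t := s :+ (t :- s)) refl s t) (2 ℕ.+ k)) p≤0)
              (<⇒≱ (near k k<n (t - s) ((begin
                - δ        ≈⟨ solve 2 (λ s δ → :- δ := s :- δ :- s) refl s δ ⟩
                s - δ - s  ≤⟨ +-monoˡ-≤ (- s) (proj₁ s-δ<t) ⟩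
                t - s      ∎) , (begin
                t - s      ≤⟨ +-monoˡ-≤ (- s) (s-upper t bad) ⟩
                s - s      ≈⟨ -‿inverseʳ s ⟩
                0#         ≤⟨ proj₁ 0<δ ⟩
                δ          ∎))))

        -- The sequence `p s` continues beyond `n`, where a Perron vector must vanish. By `p-end`
        -- the cut changes nothing at `n + 1`, the only entry beyond `n` that the eigenvalue
        -- equations see.
        x : ℕ → Carrier
        x k with k ℕₚ.≤? n
        ... | yes _ = p s k
        ... | no _  = 0#

        x≈p : ∀ {k} → k ℕ.≤ suc n → x k ≈ p s k
        x≈p {k} k≤1+n with k ℕₚ.≤? n
        ... | yes _ = refl
        ... | no k≰n with ℕₚ.≤-antisym k≤1+n (ℕₚ.≰⇒> k≰n)
        ...   | ≡.refl = sym p-end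

        x-above : ∀ {k} → n ℕ.< k → x k ≈ 0#
        x-above {k} n<k with k ℕₚ.≤? n
        ... | yes k≤n = contradiction k≤n (ℕₚ.<⇒≱ n<k)
        ... | no _    = refl

        x-perron : IsPerronVector a 0 n s x
        x-perron = record
          { positive = λ { {suc k} _ k<n → <-respʳ-≈ (sym (x≈p (ℕₚ.m≤n⇒m≤1+n k<n))) (p-pos k k<n) }
          ; below    = λ { {zero} _ → x≈p z≤n }
          ; above    = x-above
          ; eigen    = λ {k} _ k<n → trans
              (+-cong (*-congˡ (x≈p (ℕₚ.m≤n⇒m≤1+n (ℕₚ.<⇒≤ k<n)))) (*-congˡ (x≈p (s≤s k<n))))
              (trans (p-eigen s k) (*-congˡ (sym (x≈p (ℕₚ.m≤n⇒m≤1+n k<n)))))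
          }

      perronVector-exists : ∃[ t ] ∃[ x ] IsPerronVector a 0 n t x
      perronVector-exists = let (s , s-upper , s-least) = complete Bad (0# , bad-0) (threshold n , bad-bounded) in
        s , AtSupremum.x s s-upper s-least , AtSupremum.x-perron s s-upper s-least

-- Matrix rows as neighbour sums on the path.

module SpectralRadius {ℓ} (ℝ : CompleteOrderedField ℓ) where
  open OrderedField ℝ
  open Path ℝ
  open Existence ℝ
  open Spectral ℝ
  open Algebra.Properties.CommutativeMonoid.Sum +-commutativeMonoid
    using (sum; sum-cong-≋; ∑-distrib-+; sum-replicate-zero)
  open ≤-Reasoning

  private variable
    n : ℕ

  pad : Vector Carrier n → ℕ → Carrier
  pad {zero}  f k       = 0#
  pad {suc n} f zero    = f Fin.zero
  pad {suc n} f (suc k) = pad (f ∘ Fin.suc) k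

  pad-toℕ : ∀ (f : Vector Carrier n) i → pad f (toℕ i) ≡ f i
  pad-toℕ f Fin.zero    = ≡.refl
  pad-toℕ f (Fin.suc i) = pad-toℕ (f ∘ Fin.suc) i

  pad-beyond : ∀ (f : Vector Carrier n) {k} → n ℕ.≤ k → pad f k ≡ 0#
  pad-beyond {zero}  f n≤k             = ≡.refl
  pad-beyond {suc n} f {suc k} (s≤s n≤k) = pad-beyond (f ∘ Fin.suc) n≤k

  pad-restrict : ∀ {n} {g : ℕ → Carrier} → (∀ {k} → n ℕ.≤ k → g k ≈ 0#) → ∀ k → pad {n} (g ∘ toℕ) k ≈ g k
  pad-restrict {zero}  g≈0 k       = sym (g≈0 z≤n)
  pad-restrict {suc n} g≈0 zero    = refl
  pad-restrict {suc n} g≈0 (suc k) = pad-restrict {n} (g≈0 ∘ s≤s) k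

  -- A vector indexed by Fin n, placed on the vertices 1, …, n of the path.
  onPath : Vector Carrier n → ℕ → Carrier
  onPath f zero    = 0#
  onPath f (suc k) = pad f k

  -- Kronecker's delta with value `c`, by recursion on both indices so that sums over `Fin n`
  -- collapse by induction.
  δ : ℕ → ℕ → Carrier → Carrier
  δ zero    zero    c = c
  δ zero    (suc j) c = 0#
  δ (suc i) zero    c = 0#
  δ (suc i) (suc j) c = δ i j c

  δ-diag : ∀ {i j c} → i ≡ j → δ i j c ≡ c
  δ-diag {zero}  ≡.refl = ≡.refl
  δ-diag {suc i} ≡.refl = δ-diag {i} ≡.refl

  δ-off : ∀ {i j c} → i ≢ j → δ i j c ≡ 0#
  δ-off {zero}  {zero}  i≢j = contradiction ≡.refl i≢j
  δ-off {zero}  {suc j} i≢j = ≡.refl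
  δ-off {suc i} {zero}  i≢j = ≡.refl
  δ-off {suc i} {suc j} i≢j = δ-off {i} {j} (i≢j ∘ ≡.cong suc)

  sum-zero : ∀ {n} {f : Vector Carrier n} → (∀ i → f i ≈ 0#) → sum f ≈ 0#
  sum-zero {n} f≈0 = trans (sum-cong-≋ f≈0) (sum-replicate-zero n)

  -- The index `i` may lie outside `Fin n`, as it does for the right neighbour in the last row of
  -- `A`; both sides are then 0.
  sum-δ : ∀ {n} (f : Vector Carrier n) i c → sum (λ j → δ i (toℕ j) c * f j) ≈ c * pad f i
  sum-δ {zero}  f i c       = sym (zeroʳ c)
  sum-δ {suc n} f zero c    = trans (+-congˡ (sum-zero (λ j → zeroˡ (f (Fin.suc j))))) (+-identityʳ _)
  sum-δ {suc n} f (suc i) c = trans (+-cong (zeroˡ _) (sum-δ (f ∘ Fin.suc) i c)) (+-identityˡ _)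

  sum-δ-suc : ∀ {n} (f : Vector Carrier n) i c → sum (λ j → δ i (suc (toℕ j)) c * f j) ≈ c * onPath f i
  sum-δ-suc f zero c    = trans (sum-zero (λ j → zeroˡ (f j))) (sym (zeroʳ c))
  sum-δ-suc f (suc i) c = sum-δ f i c

  re-sum : ∀ {n} (v : Vector ℂ n) → re (sumℂ v) ≡ sum (re ∘ v)
  re-sum {zero}  v = ≡.refl
  re-sum {suc n} v = ≡.cong (λ x → re (v Fin.zero) + x) (re-sum (v ∘ Fin.suc))

  im-sum : ∀ {n} (v : Vector ℂ n) → im (sumℂ v) ≡ sum (im ∘ v)
  im-sum {zero}  v = ≡.refl
  im-sum {suc n} v = ≡.cong (λ x → im (v Fin.zero) + x) (im-sum (v ∘ Fin.suc))

  re-row : ∀ {n} (c : Vector Carrier n) (v : Vector ℂ n) →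
    re (sumℂ (λ j → ofReal (c j) *ℂ v j)) ≈ sum (λ j → c j * re (v j))
  re-row {n} c v = trans (reflexive (re-sum cv)) (sum-cong-≋ {n} {re ∘ cv} {λ j → c j * re (v j)} λ j →
    solve 3 (λ c x y → c :* x :- con (+ 0) :* y := c :* x) refl (c j) (re (v j)) (im (v j)))
    where
    cv : Vector ℂ n
    cv j = ofReal (c j) *ℂ v j

  im-row : ∀ {n} (c : Vector Carrier n) (v : Vector ℂ n) →
    im (sumℂ (λ j → ofReal (c j) *ℂ v j)) ≈ sum (λ j → c j * im (v j))
  im-row {n} c v = trans (reflexive (im-sum cv)) (sum-cong-≋ {n} {im ∘ cv} {λ j → c j * im (v j)} λ j →
    solve 3 (λ c x y → c :* y :+ con (+ 0) :* x := c :* y) refl (c j) (re (v j)) (im (v j)))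
    where
    cv : Vector ℂ n
    cv j = ofReal (c j) *ℂ v j

  √-upper : ∀ {x y} (0≤x : 0# ≤ x) → y * y ≤ x → y ≤ √ x 0≤x
  √-upper {x} {y} 0≤x = proj₁ (proj₂ (√-sup x 0≤x)) y

  √-least : ∀ {x t} (0≤x : 0# ≤ x) → 0# ≤ t → x ≤ t * t → √ x 0≤x ≤ t
  √-least {x} {t} 0≤x 0≤t x≤t² = proj₂ (proj₂ (√-sup x 0≤x)) t
    (λ y y²≤x → square-cancel-≤ 0≤t (Order.trans y²≤x x≤t²))

  -- The smaller of `x` and 1 is positive and its square is at most `x`.
  √-pos : ∀ {x} (0<x : 0# < x) → 0# < √ x (proj₁ 0<x)
  √-pos {x} 0<x with ≤-<-connex x 1#
  ... | inj₁ x≤1 = begin-strict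
    0#              <⟨ 0<x ⟩
    x               ≤⟨ √-upper (proj₁ 0<x) (Order.≤-respʳ-≈ (*-identityʳ x) (*-monoˡ-≤ (proj₁ 0<x) x≤1)) ⟩
    √ x (proj₁ 0<x) ∎
  ... | inj₂ 1<x = begin-strict
    0#              <⟨ 0<1 ⟩
    1#              ≤⟨ √-upper (proj₁ 0<x) (Order.≤-respˡ-≈ (sym (*-identityʳ 1#)) (proj₁ 1<x)) ⟩
    √ x (proj₁ 0<x) ∎

  module _ {r : Carrier} (0<r : 0# < r) {a : ℕ → Carrier} (0<a : ∀ k → 0# < a k)
           (a-suc : ∀ k → a (suc k) ≈ √ r (proj₁ 0<r) ^ k) where

    A-entry : ∀ {n} (i j : Fin n) → A n r 0<r i j ≈
      δ (suc (toℕ i)) (toℕ j) (a (suc (toℕ i))) + δ (toℕ i) (suc (toℕ j)) (a (toℕ i))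
    A-entry i j with toℕ j ℕₚ.≟ suc (toℕ i) | toℕ i ℕₚ.≟ suc (toℕ j)
    ... | yes j≡1+i | _ = sym (trans
      (+-cong (reflexive (δ-diag (≡.sym j≡1+i)))
              (reflexive (δ-off {toℕ i} {suc (toℕ j)} λ i≡1+j → ℕₚ.<-asym (ℕₚ.≤-reflexive (≡.sym i≡1+j)) (ℕₚ.≤-reflexive (≡.sym j≡1+i)))))
      (trans (+-identityʳ _) (a-suc (toℕ i))))
    ... | no j≢1+i | yes i≡1+j = sym (trans
      (+-cong (reflexive (δ-off {suc (toℕ i)} {toℕ j} (j≢1+i ∘ ≡.sym))) (reflexive (δ-diag i≡1+j)))
      (trans (+-identityˡ _) (trans (reflexive (≡.cong a i≡1+j)) (a-suc (toℕ j)))))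
    ... | no j≢1+i | no i≢1+j = sym (trans
      (+-cong (reflexive (δ-off {suc (toℕ i)} {toℕ j} (j≢1+i ∘ ≡.sym))) (reflexive (δ-off {toℕ i} {suc (toℕ j)} i≢1+j)))
      (+-identityˡ _))

    A-row : ∀ {n} (f : Vector Carrier n) i →
      sum (λ j → A n r 0<r i j * f j) ≈ neighbourSum a (onPath f) (toℕ i)
    A-row {n} f i = begin-equality
      sum (λ j → A n r 0<r i j * f j)       ≈⟨ sum-cong-≋ (λ j → trans (*-congʳ (A-entry i j)) (distribʳ (f j) _ _)) ⟩
      sum (λ j → upper j * f j + lower j * f j)   ≈⟨ ∑-distrib-+ (λ j → upper j * f j) (λ j → lower j * f j) ⟩
      sum (λ j → upper j * f j) + sum (λ j → lower j * f j)
        ≈⟨ +-cong (sum-δ f (suc (toℕ i)) _) (sum-δ-suc f (toℕ i) _) ⟩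
      a (suc (toℕ i)) * onPath f (2 ℕ.+ toℕ i) + a (toℕ i) * onPath f (toℕ i)
        ≈⟨ +-comm _ _ ⟩
      neighbourSum a (onPath f) (toℕ i)      ∎
      where
      upper lower : Fin n → Carrier
      upper j = δ (suc (toℕ i)) (toℕ j) (a (suc (toℕ i)))
      lower j = δ (toℕ i) (suc (toℕ j)) (a (toℕ i))

    -- The Perron eigenvalue as spectral radius.

    module _ {m : ℕ} {t : Carrier} {u : ℕ → Carrier} (u-perron : IsPerronVector a 0 (suc m) t u) where

      private
        module U = IsPerronVector u-perron

        0≤t : 0# ≤ t
        0≤t = eigenvalue-nonNeg 0<a (s≤s z≤n) u-perron

      perron-eigenvalue : IsEigenvalue (A (suc m) r 0<r) (ofReal t)
      perron-eigenvalue = v ,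
        (λ v≈0 → proj₂ (U.positive (s≤s z≤n) (s≤s z≤n)) (sym (proj₁ (v≈0 Fin.zero)))) ,
        λ i → (begin-equality
            re (sumℂ (λ j → ofReal (A (suc m) r 0<r i j) *ℂ v j))       ≈⟨ re-row (A (suc m) r 0<r i) v ⟩
            sum (λ j → A (suc m) r 0<r i j * u (suc (toℕ j)))   ≈⟨ A-row (λ j → u (suc (toℕ j))) i ⟩
            neighbourSum a (onPath (λ j → u (suc (toℕ {suc m} j)))) (toℕ i)
              ≈⟨ +-cong (*-congˡ (onPath-u (toℕ i))) (*-congˡ (onPath-u (2 ℕ.+ toℕ i))) ⟩
            neighbourSum a u (toℕ i)                            ≈⟨ U.eigen (s≤s z≤n) (Finₚ.toℕ<n i) ⟩
            t * u (suc (toℕ i))                                 ≈⟨ solve 2 (λ t x → t :* x := t :* x :- con (+ 0) :* con (+ 0)) refl t (u (suc (toℕ i))) ⟩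
            t * u (suc (toℕ i)) - 0# * 0#                       ∎) ,
          (begin-equality
            im (sumℂ (λ j → ofReal (A (suc m) r 0<r i j) *ℂ v j))       ≈⟨ im-row (A (suc m) r 0<r i) v ⟩
            sum (λ j → A (suc m) r 0<r i j * 0#)                ≈⟨ sum-zero (λ j → zeroʳ (A (suc m) r 0<r i j)) ⟩
            0#                                                  ≈⟨ solve 2 (λ t x → con (+ 0) := t :* con (+ 0) :+ con (+ 0) :* x) refl t (u (suc (toℕ i))) ⟩
            t * 0# + 0# * u (suc (toℕ i))                       ∎)
        where
        v : Vector ℂ (suc m)
        v j = ofReal (u (suc (toℕ j)))

        onPath-u : ∀ k → onPath (λ j → u (suc (toℕ {suc m} j))) k ≈ u k
        onPath-u zero    = sym (U.below z≤n)
        onPath-u (suc k) = pad-restrict {suc m} {u ∘ suc} (λ m<k → U.above (s≤s m<k)) k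

      module Bound {μ : ℂ} {v : Vector ℂ (suc m)} (v-eigen : IsEigenvector (A (suc m) r 0<r) μ v) where

        private
          x y : Carrier
          x = re μ
          y = im μ

          -- The squared modulus of the complex eigenvector is compared with the square of the
          -- Perron vector, so that no square roots enter.
          F G normSq uSq : ℕ → Carrier
          F = onPath (re ∘ v)
          G = onPath (im ∘ v)
          normSq k = F k * F k + G k * G k
          uSq k = u k * u k

          re-eigen : ∀ i → neighbourSum a F (toℕ i) ≈ x * F (suc (toℕ i)) - y * G (suc (toℕ i))
          re-eigen i = trans (sym (A-row (re ∘ v) i)) (trans (sym (re-row (A (suc m) r 0<r i) v))
            (trans (proj₁ (proj₂ v-eigen i)) (+-cong (*-congˡ (reflexive (≡.sym (pad-toℕ (re ∘ v) i))))
              (-‿cong (*-congˡ (reflexive (≡.sym (pad-toℕ (im ∘ v) i))))))))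

          im-eigen : ∀ i → neighbourSum a G (toℕ i) ≈ x * G (suc (toℕ i)) + y * F (suc (toℕ i))
          im-eigen i = trans (sym (A-row (im ∘ v) i)) (trans (sym (im-row (A (suc m) r 0<r i) v))
            (trans (proj₂ (proj₂ v-eigen i)) (+-cong (*-congˡ (reflexive (≡.sym (pad-toℕ (im ∘ v) i))))
              (*-congˡ (reflexive (≡.sym (pad-toℕ (re ∘ v) i)))))))

          normSq-nonNeg : ∀ k → 0# ≤ normSq k
          normSq-nonNeg k = +-nonNeg (x*x-nonNeg (F k)) (x*x-nonNeg (G k))

          0²+0²≈0 : 0# * 0# + 0# * 0# ≈ 0#
          0²+0²≈0 = solve 0 (con (+ 0) :* con (+ 0) :+ con (+ 0) :* con (+ 0) := con (+ 0)) refl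

          normSq-above : ∀ {k} → suc m ℕ.< k → normSq k ≈ 0#
          normSq-above {suc k} (s≤s m<k) = trans
            (+-cong (*-cong F≈0 F≈0) (*-cong G≈0 G≈0)) 0²+0²≈0
            where
            F≈0 = reflexive (pad-beyond (re ∘ v) m<k)
            G≈0 = reflexive (pad-beyond (im ∘ v) m<k)

          base : ∃[ κ ] 0# < κ × (∀ k → κ * normSq k ≤ uSq k)
          base = let (κ , 0<κ , κN≤u) = scalable {λ _ → ⊤} {normSq} {uSq} normSq-nonNeg (λ k → x*x-nonNeg (u k)) {2 ℕ.+ m} support
                 in κ , 0<κ , λ k → bound κ κN≤u k (k ℕₚ.<? 2 ℕ.+ m)
            where
            support : ∀ {k} → k ℕ.< 2 ℕ.+ m → ⊤ → 0# < normSq k → 0# < uSq k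
            support {zero}  _ _ 0<0 = contradiction (sym 0²+0²≈0) (proj₂ 0<0)
            support {suc k} (s≤s k<n) _ _ = *-pos (U.positive (s≤s z≤n) k<n) (U.positive (s≤s z≤n) k<n)
            bound : ∀ κ → (∀ k → k ℕ.< 2 ℕ.+ m → ⊤ → κ * normSq k ≤ uSq k) → ∀ k → Dec (k ℕ.< 2 ℕ.+ m) → κ * normSq k ≤ uSq k
            bound κ κN≤u k (yes k<n) = κN≤u k k<n _
            bound κ κN≤u k (no k≮n)  = begin
              κ * normSq k  ≈⟨ *-congˡ (normSq-above (ℕₚ.≮⇒≥ k≮n)) ⟩
              κ * 0#        ≈⟨ zeroʳ κ ⟩
              0#            ≤⟨ x*x-nonNeg (u k) ⟩
              uSq k         ∎

          module _ {κ} (0<κ : 0# < κ) (κN≤u : ∀ k → κ * normSq k ≤ uSq k) where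

            0≤κ = proj₁ 0<κ

            -- Cauchy–Schwarz via Lagrange's identity; u k or u l may be 0, hence the squares.
            cross : ∀ k l → κ * (F k * F l + G k * G l) ≤ u k * u l
            cross k l = square-cancel-≤ (*-nonNeg (U.nonNeg k) (U.nonNeg l)) (begin
              κ * (F k * F l + G k * G l) * (κ * (F k * F l + G k * G l))
                ≤⟨ x²≤x²+y² _ _ ⟩
              κ * (F k * F l + G k * G l) * (κ * (F k * F l + G k * G l)) +
              κ * (F k * G l - G k * F l) * (κ * (F k * G l - G k * F l))
                ≈⟨ solve 5 (λ κ f g f′ g′ →
                     κ :* (f :* f′ :+ g :* g′) :* (κ :* (f :* f′ :+ g :* g′)) :+
                     κ :* (f :* g′ :- g :* f′) :* (κ :* (f :* g′ :- g :* f′)) :=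
                     κ :* (f :* f :+ g :* g) :* (κ :* (f′ :* f′ :+ g′ :* g′))) refl κ (F k) (G k) (F l) (G l) ⟩
              κ * normSq k * (κ * normSq l)
                ≤⟨ *-mono-≤ (*-nonNeg 0≤κ (normSq-nonNeg k)) (x*x-nonNeg (u l)) (κN≤u k) (κN≤u l) ⟩
              uSq k * uSq l
                ≈⟨ solve 2 (λ u u′ → u :* u :* (u′ :* u′) := u :* u′ :* (u :* u′)) refl (u k) (u l) ⟩
              u k * u l * (u k * u l) ∎)

            -- A squared triangle inequality: the expansion has two squared moduli and a mixed term
            -- bounded by `cross`, all with non-negative weights, and the bounds recombine to a
            -- square.
            neighbourSum-bound : ∀ k →
              κ * (neighbourSum a F k * neighbourSum a F k + neighbourSum a G k * neighbourSum a G k) ≤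
              neighbourSum a u k * neighbourSum a u k
            neighbourSum-bound k = begin
              κ * (neighbourSum a F k * neighbourSum a F k + neighbourSum a G k * neighbourSum a G k)
                ≈⟨ solve 7 (λ κ a b f f′ g g′ →
                     κ :* ((a :* f :+ b :* f′) :* (a :* f :+ b :* f′) :+ (a :* g :+ b :* g′) :* (a :* g :+ b :* g′)) :=
                     a :* a :* (κ :* (f :* f :+ g :* g)) :+ b :* b :* (κ :* (f′ :* f′ :+ g′ :* g′)) :+
                     (con (+ 1) :+ con (+ 1)) :* (a :* b) :* (κ :* (f :* f′ :+ g :* g′)))
                     refl κ (a k) (a (suc k)) (F k) (F (2 ℕ.+ k)) (G k) (G (2 ℕ.+ k)) ⟩
              a k * a k * (κ * normSq k) + a (suc k) * a (suc k) * (κ * normSq (2 ℕ.+ k)) +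
              (1# + 1#) * (a k * a (suc k)) * (κ * (F k * F (2 ℕ.+ k) + G k * G (2 ℕ.+ k)))
                ≤⟨ +-mono-≤ (+-mono-≤ (*-monoˡ-≤ (x*x-nonNeg (a k)) (κN≤u k)) (*-monoˡ-≤ (x*x-nonNeg (a (suc k))) (κN≤u (2 ℕ.+ k))))
                     (*-monoˡ-≤ (*-nonNeg (proj₁ 0<2) (*-nonNeg (proj₁ (0<a k)) (proj₁ (0<a (suc k))))) (cross k (2 ℕ.+ k))) ⟩
              a k * a k * uSq k + a (suc k) * a (suc k) * uSq (2 ℕ.+ k) +
              (1# + 1#) * (a k * a (suc k)) * (u k * u (2 ℕ.+ k))
                ≈⟨ solve 4 (λ a b f f′ →
                     a :* a :* (f :* f) :+ b :* b :* (f′ :* f′) :+ (con (+ 1) :+ con (+ 1)) :* (a :* b) :* (f :* f′) :=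
                     (a :* f :+ b :* f′) :* (a :* f :+ b :* f′)) refl (a k) (a (suc k)) (u k) (u (2 ℕ.+ k)) ⟩
              neighbourSum a u k * neighbourSum a u k ∎

            inside : ∀ i → κ * ((x * x + y * y) * normSq (suc (toℕ i))) ≤ t * t * uSq (suc (toℕ i))
            inside i = begin
              κ * ((x * x + y * y) * normSq (suc k))
                -- The two-square identity |μ|² |v|² = |μ v|².
                ≈⟨ *-congˡ (solve 4 (λ x y f g → (x :* x :+ y :* y) :* (f :* f :+ g :* g) :=
                     (x :* f :- y :* g) :* (x :* f :- y :* g) :+ (x :* g :+ y :* f) :* (x :* g :+ y :* f)) refl x y (F (suc k)) (G (suc k))) ⟩
              κ * ((x * F (suc k) - y * G (suc k)) * (x * F (suc k) - y * G (suc k)) +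
                   (x * G (suc k) + y * F (suc k)) * (x * G (suc k) + y * F (suc k)))
                ≈⟨ *-congˡ (+-cong (*-cong (re-eigen i) (re-eigen i)) (*-cong (im-eigen i) (im-eigen i))) ⟨
              κ * (neighbourSum a F k * neighbourSum a F k + neighbourSum a G k * neighbourSum a G k)
                ≤⟨ neighbourSum-bound k ⟩
              neighbourSum a u k * neighbourSum a u k
                ≈⟨ *-cong u-eigen u-eigen ⟩
              t * u (suc k) * (t * u (suc k))
                ≈⟨ solve 2 (λ t u → t :* u :* (t :* u) := t :* t :* (u :* u)) refl t (u (suc k)) ⟩
              t * t * uSq (suc k) ∎
              where
              k = toℕ i
              u-eigen = U.eigen (s≤s z≤n) (Finₚ.toℕ<n i)

            outside : ∀ {k} → normSq k ≈ 0# → κ * ((x * x + y * y) * normSq k) ≤ t * t * uSq k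
            outside {k} N≈0 = begin
              κ * ((x * x + y * y) * normSq k)  ≈⟨ *-congˡ (*-congˡ N≈0) ⟩
              κ * ((x * x + y * y) * 0#)        ≈⟨ solve 2 (λ κ s → κ :* (s :* con (+ 0)) := con (+ 0)) refl κ (x * x + y * y) ⟩
              0#                                ≤⟨ *-nonNeg (x*x-nonNeg t) (x*x-nonNeg (u k)) ⟩
              t * t * uSq k                     ∎

            step : ∀ k → κ * ((x * x + y * y) * normSq k) ≤ t * t * uSq k
            step zero = outside 0²+0²≈0
            step (suc k) with k ℕₚ.<? suc m
            ... | no k≮n = outside (normSq-above (s≤s (ℕₚ.≮⇒≥ k≮n)))
            ... | yes k<n = ≡.subst (λ k → κ * ((x * x + y * y) * normSq (suc k)) ≤ t * t * uSq (suc k))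
              (Finₚ.toℕ-fromℕ< k<n) (inside (fromℕ< k<n))

          nonzero : ¬ (∀ k → normSq k ≤ 0#)
          nonzero N≤0 = proj₁ v-eigen λ i →
            let F² = ≡.subst₂ (λ f g → f * f + g * g ≤ 0#) (pad-toℕ (re ∘ v) i) (pad-toℕ (im ∘ v) i) (N≤0 (suc (toℕ i)))
            in square≤0⇒≈0 (Order.trans (x²≤x²+y² _ _) F²) ,
               square≤0⇒≈0 (Order.trans (x²≤x²+y² _ _) (Order.≤-respˡ-≈ (+-comm _ _) F²))

        -- `contraction` with the factors |μ|² and t² gives |μ|² ≤ t², and the root is then at most
        -- `t`.
        modulus-bound : ∣ μ ∣ ≤ t
        modulus-bound = √-least _ 0≤t (contraction normSq uSq (x*x-nonNeg t) base (λ _ → step) nonzero)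

      -- `ρ` is the modulus of some eigenvalue and hence at most `t`; conversely `t` is an
      -- eigenvalue, so its modulus is at most `ρ`.
      spectralRadius≈eigenvalue : ∀ {ρ} → IsSpectralRadius (A (suc m) r 0<r) ρ → ρ ≈ t
      spectralRadius≈eigenvalue {ρ} ((μ , (v , v-eigen) , ∣μ∣≈ρ) , maximal) = Order.antisym
        (begin
          ρ     ≈⟨ ∣μ∣≈ρ ⟨
          ∣ μ ∣ ≤⟨ Bound.modulus-bound v-eigen ⟩
          t     ∎)
        (begin
          t            ≤⟨ √-upper _ (x²≤x²+y² t 0#) ⟩
          ∣ ofReal t ∣ ≤⟨ maximal (ofReal t) perron-eigenvalue ⟩
          ρ            ∎)

  -- Geometric weights and log-concavity.

  shift : (ℕ → Carrier) → ℕ → Carrier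
  shift x zero    = 0#
  shift x (suc k) = x k

  -- Moving a segment one vertex to the right multiplies its geometric weights by `s`, and therefore
  -- its eigenvalue. The segments without the first vertex thus inherit Perron vectors from those
  -- starting there.
  shift-perron : ∀ {a s lo hi t x} → (∀ k → a (suc k) ≈ s * a k) →
    IsPerronVector a lo hi t x → IsPerronVector a (suc lo) (suc hi) (s * t) (shift x)
  shift-perron {a} {s} {t = t} {x} geometric x-perron = record
    { positive = λ { {suc k} (s≤s lo<k) (s≤s k≤hi) → X.positive lo<k k≤hi }
    ; below    = λ { {zero} _ → refl ; {suc k} (s≤s k≤lo) → X.below k≤lo }
    ; above    = λ { {suc k} (s≤s hi<k) → X.above hi<k }
    ; eigen    = λ { {suc k} (s≤s lo<k) (s≤s k≤hi) → begin-equality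
        a (suc k) * x k + a (2 ℕ.+ k) * x (2 ℕ.+ k)
          ≈⟨ +-cong (*-congʳ (geometric k)) (*-congʳ (geometric (suc k))) ⟩
        s * a k * x k + s * a (suc k) * x (2 ℕ.+ k)
          ≈⟨ solve 5 (λ s a b x y → s :* a :* x :+ s :* b :* y := s :* (a :* x :+ b :* y)) refl s (a k) (a (suc k)) (x k) (x (2 ℕ.+ k)) ⟩
        s * neighbourSum a x k
          ≈⟨ *-congˡ (X.eigen lo<k k≤hi) ⟩
        s * (t * x (suc k))
          ≈⟨ *-assoc s t _ ⟨
        s * t * x (suc k) ∎ }
    }
    where module X = IsPerronVector x-perron

  module LogConcavity {r : Carrier} (0<r : 0# < r) where

    private
      s = √ r (proj₁ 0<r)

    -- The weights s⁻¹, 1, s, s², …: the first one only meets the zero entry at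
    -- vertex 0, and its value makes the sequence geometric.
    module Weights {s⁻¹} (0<s⁻¹ : 0# < s⁻¹) (ss⁻¹≈1 : s * s⁻¹ ≈ 1#) where

      a : ℕ → Carrier
      a k = s⁻¹ * s ^ k

      s^-pos : ∀ k → 0# < s ^ k
      s^-pos zero    = 0<1
      s^-pos (suc k) = *-pos (√-pos 0<r) (s^-pos k)

      0<a : ∀ k → 0# < a k
      0<a k = *-pos 0<s⁻¹ (s^-pos k)

      geometric : ∀ k → a (suc k) ≈ s * a k
      geometric k = solve 3 (λ r s p → r :* (s :* p) := s :* (r :* p)) refl s⁻¹ s (s ^ k)

      a-suc : ∀ k → a (suc k) ≈ s ^ k
      a-suc k = trans (solve 3 (λ r s p → r :* (s :* p) := s :* r :* p) refl s⁻¹ s (s ^ k))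
                      (trans (*-congʳ ss⁻¹≈1) (*-identityˡ _))

      -- The comparison with `l = 0` and `h = m + 2` reads `t₃ * (s * t₁) ≤ t₂ * (s * t₂)`, where
      -- `s` cancels. Non-negativity of the product is recorded for squaring the inequality later.
      log-concave : ∀ m {ρ₁ ρ₂ ρ₃} → IsSpectralRadius (A (1 ℕ.+ m) r 0<r) ρ₁ →
        IsSpectralRadius (A (2 ℕ.+ m) r 0<r) ρ₂ → IsSpectralRadius (A (3 ℕ.+ m) r 0<r) ρ₃ →
        0# ≤ ρ₁ * ρ₃ × ρ₁ * ρ₃ ≤ ρ₂ * ρ₂
      log-concave m {ρ₁} {ρ₂} {ρ₃} ρ₁-radius ρ₂-radius ρ₃-radius =
        let (t₁ , x₁ , perron₁) = perron m
            (t₂ , x₂ , perron₂) = perron (1 ℕ.+ m)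
            (t₃ , x₃ , perron₃) = perron (2 ℕ.+ m)
            ρ₁≈t₁ = spectralRadius≈eigenvalue 0<r 0<a a-suc perron₁ ρ₁-radius
            ρ₂≈t₂ = spectralRadius≈eigenvalue 0<r 0<a a-suc perron₂ ρ₂-radius
            ρ₃≈t₃ = spectralRadius≈eigenvalue 0<r 0<a a-suc perron₃ ρ₃-radius
        in Order.≤-respʳ-≈ (*-cong (sym ρ₁≈t₁) (sym ρ₃≈t₃))
             (*-nonNeg (eigenvalue-nonNeg 0<a (s≤s z≤n) perron₁) (eigenvalue-nonNeg 0<a (s≤s z≤n) perron₃)) ,
           *-cancelˡ-≤ (√-pos 0<r) (begin
             s * (ρ₁ * ρ₃)  ≈⟨ *-congˡ (*-cong ρ₁≈t₁ ρ₃≈t₃) ⟩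
             s * (t₁ * t₃)  ≈⟨ solve 3 (λ s p q → s :* (p :* q) := q :* (s :* p)) refl s t₁ t₃ ⟩
             t₃ * (s * t₁)  ≤⟨ Comparison.comparison 0<a (s≤s (s≤s z≤n)) perron₃ (shift-perron geometric perron₁)
                                 perron₂ (shift-perron geometric perron₂) ⟩
             t₂ * (s * t₂)  ≈⟨ solve 2 (λ s p → p :* (s :* p) := s :* (p :* p)) refl s t₂ ⟩
             s * (t₂ * t₂)  ≈⟨ *-congˡ (*-cong ρ₂≈t₂ ρ₂≈t₂) ⟨
             s * (ρ₂ * ρ₂)  ∎)
        where
        perron : ∀ n → ∃[ t ] ∃[ x ] IsPerronVector a 0 (suc n) t x
        perron = Recurrence.perronVector-exists 0<a

    log-concave : ∀ m {ρ₁ ρ₂ ρ₃} → IsSpectralRadius (A (1 ℕ.+ m) r 0<r) ρ₁ →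
      IsSpectralRadius (A (2 ℕ.+ m) r 0<r) ρ₂ → IsSpectralRadius (A (3 ℕ.+ m) r 0<r) ρ₃ →
      0# ≤ ρ₁ * ρ₃ × ρ₁ * ρ₃ ≤ ρ₂ * ρ₂
    log-concave = let (_ , 0<s⁻¹ , ss⁻¹≈1) = reciprocal (√-pos 0<r) in Weights.log-concave 0<s⁻¹ ss⁻¹≈1

  ^2≈* : ∀ x → x ^ 2 ≈ x * x
  ^2≈* x = *-congˡ (*-identityʳ x)

theorem7p3 :
    ∀ {ℓ} (ℝ : CompleteOrderedField ℓ) →
    let open CompleteOrderedField ℝ
        open Spectral ℝ
    in
    ∀ (h : ℕ) → 2 ℕ.≤ h →
    ∀ (r : Carrier) (0<r : 0# < r) →
    ∀ (λₕ₋₁ λₕ λₕ₊₁ : Carrier) →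
    IsSpectralRadius (A (h ∸ 1) r 0<r) λₕ₋₁ →
    IsSpectralRadius (A h r 0<r) λₕ →
    IsSpectralRadius (A (h ℕ.+ 1) r 0<r) λₕ₊₁ →
    let Λₕ₋₁ = λₕ₋₁ ^ 2
        Λₕ   = λₕ ^ 2
        Λₕ₊₁ = λₕ₊₁ ^ 2
    in
    (λₕ₋₁ * λₕ₊₁ ≤ λₕ ^ 2) × (Λₕ₋₁ * Λₕ₊₁ ≤ Λₕ ^ 2)
theorem7p3 ℝ (suc (suc m)) (s≤s (s≤s z≤n)) r 0<r x y z x-radius y-radius z-radius =
  Order.≤-respʳ-≈ (sym (^2≈* y)) xz≤y² , (begin
    x ^ 2 * z ^ 2       ≈⟨ *-cong (^2≈* x) (^2≈* z) ⟩
    x * x * (z * z)     ≈⟨ solve 2 (λ x z → x :* x :* (z :* z) := x :* z :* (x :* z)) refl x z ⟩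
    -- The first inequality may be squared because `x * z` is non-negative.
    x * z * (x * z)     ≤⟨ *-mono-≤ 0≤xz (x*x-nonNeg y) xz≤y² xz≤y² ⟩
    y * y * (y * y)     ≈⟨ *-cong (^2≈* y) (^2≈* y) ⟨
    y ^ 2 * y ^ 2       ≈⟨ ^2≈* (y ^ 2) ⟨
    (y ^ 2) ^ 2         ∎)
  where
  open OrderedField ℝ
  open Spectral ℝ
  open SpectralRadius ℝ
  open ≤-Reasoning
  bounds = LogConcavity.log-concave 0<r m x-radius y-radius
    -- The size `h + 1` does not reduce to `3 + m` by computation.
    (≡.subst (λ n → IsSpectralRadius (A n r 0<r) z) (ℕₚ.+-comm (2 ℕ.+ m) 1) z-radius)
  0≤xz = proj₁ bounds
  xz≤y² = proj₂ bounds
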